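{- For any finite graph $G$, the extended permutohedron $\mathsf{R}(G)$ is a bounded homomorphic image of a free lattice.
   Context: For a graph $G$ (irreflexive symmetric relation on a vertex set), let $\mathcal{C}(G)$ be the set of all nonempty connected subsets of $G$ (connected as induced subgraphs). For $\boldsymbol{x}\subseteq\mathcal{C}(G)$, $\varphi(\boldsymbol{x})$ is the set of all $X\in\mathcal{C}(G)$ that are the disjoint union of some nonempty finite subset of $\boldsymbol{x}$. This is a closure operator on $\mathcal{C}(G)$; its interior is $\check\varphi(\boldsymbol{x})=\mathcal{C}(G)\setminus\varphi(\mathcal{C}(G)\setminus\boldsymbol{x})$. $\mathsf{R}(G)$ is the lattice of regular closed subsets of $\mathcal{C}(G)$ (those $\boldsymbol{x}$ with $\boldsymbol{x}=\varphi\check\varphi(\boldsymbol{x})$), ordered by inclusion. A lattice $L$ is a bounded homomorphic image of a free lattice if there is a free lattice $F$ and a surjective lattice homomorphism $f\colon F\to L$ such that each $f^{ -1}\{x\}$ has a least and a largest element. -}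

module Defs where

open import Data.Nat using (ℕ)
open import Data.Bool using (Bool; true; false; T)
open import Data.Fin using (Fin)
open import Data.Fin.Subset using (Subset; _∈_; _∩_; _∪_; ⊥; Nonempty; Empty)
open import Data.List using (List; []; _∷_; foldr)
open import Data.List.Relation.Unary.All using (All)
open import Data.List.Relation.Unary.AllPairs using (AllPairs)
open import Data.Product using (Σ; ∃; _×_; _,_)
open import Relation.Binary.PropositionalEquality using (_≡_)
open import Relation.Nullary using (¬_)
open import Function.Bundles using (_⇔_)

record Graph (n : ℕ) : Set where
  field
    adj    : Fin n → Fin n → Bool
    irrefl : ∀ i → adj i i ≡ false
    sym    : ∀ i j → adj i j ≡ adj j i

open Graph public

Pred : ℕ → Set₁
Pred n = Subset n → Set

module _ {n : ℕ} (G : Graph n) where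

  data PathIn (X : Subset n) : Fin n → Fin n → Set where
    here : ∀ {u} → u ∈ X → PathIn X u u
    step : ∀ {u v w} → u ∈ X → T (adj G u v) → PathIn X v w → PathIn X u w

  Connected : Subset n → Set
  Connected X = Nonempty X × (∀ u v → u ∈ X → v ∈ X → PathIn X u v)

  InC : Pred n
  InC = Connected

  Disjoint : Subset n → Subset n → Set
  Disjoint Y Z = Empty (Y ∩ Z)

  ⋃ : List (Subset n) → Subset n
  ⋃ = foldr _∪_ ⊥

  φ : Pred n → Pred n
  φ x X = InC X × Σ (List (Subset n)) λ Ys →
            ¬ (Ys ≡ []) × All x Ys × AllPairs Disjoint Ys × ⋃ Ys ≡ X

  Cᶜ : Pred n → Pred n
  Cᶜ x X = InC X × ¬ x X

  φ̌ : Pred n → Pred n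
  φ̌ x = Cᶜ (φ (Cᶜ x))

  -- Subsets of 𝒞(G) are represented by (decidable) Boolean predicates.
  ToPred : (Subset n → Bool) → Pred n
  ToPred x X = T (x X)

  RegularClosed : (Subset n → Bool) → Set
  RegularClosed x = (∀ X → ToPred x X → InC X)
                  × (∀ X → ToPred x X ⇔ φ (φ̌ (ToPred x)) X)

  RG : Set
  RG = Σ (Subset n → Bool) RegularClosed

  _⊆R_ : RG → RG → Set
  (x , _) ⊆R (y , _) = ∀ X → T (x X) → T (y X)

  _≈R_ : RG → RG → Set
  (x , _) ≈R (y , _) = ∀ X → x X ≡ y X

  IsLubR : RG → RG → RG → Set
  IsLubR a b c = a ⊆R c × b ⊆R c × (∀ d → a ⊆R d → b ⊆R d → c ⊆R d)

  IsGlbR : RG → RG → RG → Set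
  IsGlbR a b c = c ⊆R a × c ⊆R b × (∀ d → d ⊆R a → d ⊆R b → d ⊆R c)

-- The free lattice F(X): lattice terms over X modulo the least
-- congruence generated by the lattice axioms.

data Term (X : Set) : Set where
  var  : X → Term X
  _∨ₜ_ : Term X → Term X → Term X
  _∧ₜ_ : Term X → Term X → Term X

infixr 6 _∨ₜ_
infixr 7 _∧ₜ_
infix 4 _≈ₜ_ _≤ₜ_

data _≈ₜ_ {X : Set} : Term X → Term X → Set where
  ≈-refl  : ∀ {s} → s ≈ₜ s
  ≈-sym   : ∀ {s t} → s ≈ₜ t → t ≈ₜ s
  ≈-trans : ∀ {s t u} → s ≈ₜ t → t ≈ₜ u → s ≈ₜ u
  ∨-cong  : ∀ {s s′ t t′} → s ≈ₜ s′ → t ≈ₜ t′ → (s ∨ₜ t) ≈ₜ (s′ ∨ₜ t′)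
  ∧-cong  : ∀ {s s′ t t′} → s ≈ₜ s′ → t ≈ₜ t′ → (s ∧ₜ t) ≈ₜ (s′ ∧ₜ t′)
  ∨-comm  : ∀ s t → (s ∨ₜ t) ≈ₜ (t ∨ₜ s)
  ∧-comm  : ∀ s t → (s ∧ₜ t) ≈ₜ (t ∧ₜ s)
  ∨-assoc : ∀ s t u → ((s ∨ₜ t) ∨ₜ u) ≈ₜ (s ∨ₜ (t ∨ₜ u))
  ∧-assoc : ∀ s t u → ((s ∧ₜ t) ∧ₜ u) ≈ₜ (s ∧ₜ (t ∧ₜ u))
  ∨-absorbs-∧ : ∀ s t → (s ∨ₜ (s ∧ₜ t)) ≈ₜ s
  ∧-absorbs-∨ : ∀ s t → (s ∧ₜ (s ∨ₜ t)) ≈ₜ s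

_≤ₜ_ : {X : Set} → Term X → Term X → Set
s ≤ₜ t = (s ∧ₜ t) ≈ₜ s

module _ {n : ℕ} (G : Graph n) (X : Set) where

  record IsLatticeHomToR (f : Term X → RG G) : Set where
    field
      resp  : ∀ {s t} → s ≈ₜ t → _≈R_ G (f s) (f t)
      hom-∨ : ∀ s t → IsLubR G (f s) (f t) (f (s ∨ₜ t))
      hom-∧ : ∀ s t → IsGlbR G (f s) (f t) (f (s ∧ₜ t))

  Surjective : (Term X → RG G) → Set
  Surjective f = ∀ y → ∃ λ t → _≈R_ G (f t) y

  Bounded : (Term X → RG G) → Set
  Bounded f = ∀ y →
      (∃ λ t → _≈R_ G (f t) y × (∀ s → _≈R_ G (f s) y → t ≤ₜ s))
    × (∃ λ t → _≈R_ G (f t) y × (∀ s → _≈R_ G (f s) y → s ≤ₜ t))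

BoundedHomImageOfFree : {n : ℕ} → Graph n → Set₁
BoundedHomImageOfFree G =
  Σ Set λ X → Σ (Term X → RG G) λ f →
    IsLatticeHomToR G X f × Surjective G X f × Bounded G X f

module Submission where

-- Connected sets split as X = Y ⊔ Z, and φ is the closure under such binary
-- unions, because two adjacent pieces of a partition of X can be merged.  Every
-- regular closed set is the union of the closures of neighbourhoods (p, u): u
-- open, all of its members other than p smaller than p.  A nontrivial cover of
-- (p, u) by b and c refines to neighbourhoods below b or c that have either a
-- smaller apex or the same apex and a smaller open set.  The only delicate case
-- is p ∈ b, where the interior of u ∩ b replaces u; it can miss p only if p is
-- generated by smaller members, since closed sets z₁, z₂ always satisfy
-- Cl (z₁ ∪ z₂) = (z₁ ∩ z₂) ∪ Cl (z₁ △ z₂).  As this refinement is well founded,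
-- the terms above any given element have a least one; complementation yields
-- the dual.

open import Defs renaming (sym to adj-sym)
open import Data.Nat using (ℕ)

-- Order, duality and least terms in a free lattice.

module FreeLattice where

  open import Data.Product using (∃; _×_; _,_; proj₁; proj₂)
  open import Data.Sum using (_⊎_; inj₁; inj₂)
  open import Data.List using (List; []; _∷_; foldr; filter)
  open import Data.List.Membership.Propositional using () renaming (_∈_ to _∈ᴸ_)
  open import Data.List.Membership.Propositional.Properties using (∈-filter⁺; ∈-filter⁻)
  open import Data.List.Relation.Unary.Any using () renaming (here to hereᴸ; there to thereᴸ)
  open import Relation.Binary using (Rel)
  open import Induction.WellFounded using (WellFounded; module All)
  open import Relation.Binary.PropositionalEquality using (_≡_; refl)
  open import Relation.Nullary using (Dec)
  open import Level using (0ℓ)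
  import Algebra.Lattice as Alg
  import Algebra.Lattice.Properties.Lattice as LatticeProperties
  import Relation.Binary.Lattice as Ord

  termLattice : Set → Alg.Lattice 0ℓ 0ℓ
  termLattice X = record
    { Carrier   = Term X
    ; _≈_       = _≈ₜ_
    ; _∨_       = _∨ₜ_
    ; _∧_       = _∧ₜ_
    ; isLattice = record
      { isEquivalence = record { refl = ≈-refl ; sym = ≈-sym ; trans = ≈-trans }
      ; ∨-comm        = ∨-comm
      ; ∨-assoc       = ∨-assoc
      ; ∨-cong        = ∨-cong
      ; ∧-comm        = ∧-comm
      ; ∧-assoc       = ∧-assoc
      ; ∧-cong        = ∧-cong
      ; absorptive    = ∨-absorbs-∧ , ∧-absorbs-∨
      }
    }

  module _ {X : Set} where

    private
      -- The order of `L` is `s ≈ s ∧ t`, the mirror image of `_≤ₜ_`, hence the uses of `≈-sym`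
      -- below.
      module L = Ord.Lattice
        (LatticeProperties.∨-∧-orderTheoreticLattice (termLattice X))

    ≤ₜ-refl : {s : Term X} → s ≤ₜ s
    ≤ₜ-refl = ≈-sym L.refl

    ≤ₜ-trans : {s t u : Term X} → s ≤ₜ t → t ≤ₜ u → s ≤ₜ u
    ≤ₜ-trans p q = ≈-sym (L.trans (≈-sym p) (≈-sym q))

    s≤s∨t : (s t : Term X) → s ≤ₜ s ∨ₜ t
    s≤s∨t s t = ≈-sym (L.x≤x∨y s t)

    t≤s∨t : (s t : Term X) → t ≤ₜ s ∨ₜ t
    t≤s∨t s t = ≈-sym (L.y≤x∨y s t)

    ∨ₜ-least : {s t u : Term X} → s ≤ₜ u → t ≤ₜ u → s ∨ₜ t ≤ₜ u
    ∨ₜ-least p q = ≈-sym (L.∨-least (≈-sym p) (≈-sym q))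

    s∧t≤s : (s t : Term X) → s ∧ₜ t ≤ₜ s
    s∧t≤s s t = ≈-sym (L.x∧y≤x s t)

    s∧t≤t : (s t : Term X) → s ∧ₜ t ≤ₜ t
    s∧t≤t s t = ≈-sym (L.x∧y≤y s t)

    ∧ₜ-greatest : {s t u : Term X} → u ≤ₜ s → u ≤ₜ t → u ≤ₜ s ∧ₜ t
    ∧ₜ-greatest p q = ≈-sym (L.∧-greatest (≈-sym p) (≈-sym q))

    dual : Term X → Term X
    dual (var x)  = var x
    dual (s ∨ₜ t) = dual s ∧ₜ dual t
    dual (s ∧ₜ t) = dual s ∨ₜ dual t

    dual-involutive : (t : Term X) → dual (dual t) ≡ t
    dual-involutive (var x) = refl
    dual-involutive (s ∨ₜ t) rewrite dual-involutive s | dual-involutive t = refl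
    dual-involutive (s ∧ₜ t) rewrite dual-involutive s | dual-involutive t = refl

    dual-cong : {s t : Term X} → s ≈ₜ t → dual s ≈ₜ dual t
    dual-cong ≈-refl            = ≈-refl
    dual-cong (≈-sym p)         = ≈-sym (dual-cong p)
    dual-cong (≈-trans p q)     = ≈-trans (dual-cong p) (dual-cong q)
    dual-cong (∨-cong p q)      = ∧-cong (dual-cong p) (dual-cong q)
    dual-cong (∧-cong p q)      = ∨-cong (dual-cong p) (dual-cong q)
    dual-cong (∨-comm s t)      = ∧-comm (dual s) (dual t)
    dual-cong (∧-comm s t)      = ∨-comm (dual s) (dual t)
    dual-cong (∨-assoc s t u)   = ∧-assoc (dual s) (dual t) (dual u)
    dual-cong (∧-assoc s t u)   = ∨-assoc (dual s) (dual t) (dual u)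
    dual-cong (∨-absorbs-∧ s t) = ∧-absorbs-∨ (dual s) (dual t)
    dual-cong (∧-absorbs-∨ s t) = ∨-absorbs-∧ (dual s) (dual t)

    -- Dualizing `s ∧ₜ t ≈ₜ s` gives `dual s ≈ₜ dual t ∨ₜ dual s`, and absorption does the rest.
    dual-antitone : {s t : Term X} → s ≤ₜ t → dual t ≤ₜ dual s
    dual-antitone {s} {t} p =
      ≈-trans (∧-cong ≈-refl (≈-trans (≈-sym (dual-cong p)) (∨-comm (dual s) (dual t))))
              (∧-absorbs-∨ (dual t) (dual s))

  module FiniteVars {X : Set} (x₀ : X) (xs : List X) (complete : ∀ x → x ∈ᴸ xs) where

    -- The first argument ends the meet, as terms have no constructor for an empty one.
    ⋀-vars : Term X → List X → Term X
    ⋀-vars = foldr (λ x t → var x ∧ₜ t)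

    ⋀-vars-lower : ∀ t {x ys} → x ∈ᴸ ys → ⋀-vars t ys ≤ₜ var x
    ⋀-vars-lower t {ys = y ∷ ys} (hereᴸ refl) = s∧t≤s _ _
    ⋀-vars-lower t {ys = y ∷ ys} (thereᴸ i) = ≤ₜ-trans (s∧t≤t _ _) (⋀-vars-lower t i)

    -- With finitely many generators, their meet is a least term. It serves as the join of an empty
    -- cover.
    ⊥ₜ : Term X
    ⊥ₜ = ⋀-vars (var x₀) xs

    ⊥ₜ-min : ∀ t → ⊥ₜ ≤ₜ t
    ⊥ₜ-min (var x)  = ⋀-vars-lower (var x₀) (complete x)
    ⊥ₜ-min (s ∨ₜ t) = ≤ₜ-trans (⊥ₜ-min s) (s≤s∨t s t)
    ⊥ₜ-min (s ∧ₜ t) = ∧ₜ-greatest (⊥ₜ-min s) (⊥ₜ-min t)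

    -- Day–McKenzie: if every nontrivial join cover of an element j refines to
    -- one of finitely many covers by elements of lower rank, the terms above j
    -- have a least one, namely the meet of all generators above j and of the
    -- joins, over these covers, of the least terms already found.
    module JoinCovers {J : Set} (_≺_ : Rel J 0ℓ) (≺-wf : WellFounded _≺_)
      (_⊩_ : J → Term X → Set)
      (⊩var? : ∀ j x → Dec (j ⊩ var x))
      (⊩var : ∀ j → ∃ λ x → j ⊩ var x)
      (⊩-mono : ∀ j {s t} → s ≤ₜ t → j ⊩ s → j ⊩ t)
      (⊩-∧ : ∀ j s t → j ⊩ s → j ⊩ t → j ⊩ (s ∧ₜ t))
      (covers : J → List (List J))
      (covers-≺ : ∀ j {C} → C ∈ᴸ covers j → ∀ {c} → c ∈ᴸ C → c ≺ j)
      (covers-sound : ∀ j {C} → C ∈ᴸ covers j → ∀ t → (∀ {c} → c ∈ᴸ C → c ⊩ t) → j ⊩ t)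
      (covers-complete : ∀ j s t → j ⊩ (s ∨ₜ t) → (j ⊩ s) ⊎ (j ⊩ t) ⊎
         ∃ λ C → C ∈ᴸ covers j × (∀ {c} → c ∈ᴸ C → (c ⊩ s) ⊎ (c ⊩ t)))
      where

      Least : J → Set
      Least j = ∃ λ t → j ⊩ t × (∀ s → j ⊩ s → t ≤ₜ s)

      -- Each member of `C` chooses its own side, which is the form in which `covers-complete`
      -- delivers a refined cover.
      BelowJoins : Term X → List J → Set
      BelowJoins t C = ∀ s s′ → (∀ {c} → c ∈ᴸ C → (c ⊩ s) ⊎ (c ⊩ s′)) → t ≤ₜ s ∨ₜ s′

      ⋁-least : (C : List J) → (∀ {c} → c ∈ᴸ C → Least c) →
        ∃ λ t → (∀ {c} → c ∈ᴸ C → c ⊩ t) × BelowJoins t C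
      ⋁-least [] least = ⊥ₜ , (λ ()) , λ s s′ _ → ⊥ₜ-min (s ∨ₜ s′)
      ⋁-least (c ∷ C) least with least (hereᴸ refl) | ⋁-least C (λ i → least (thereᴸ i))
      ... | t , c⊩t , t-min | u , C⊩u , u-min =
        t ∨ₜ u
        , (λ { (hereᴸ refl) → ⊩-mono c (s≤s∨t t u) c⊩t
             ; (thereᴸ i)   → ⊩-mono _ (t≤s∨t t u) (C⊩u i) })
        , λ s s′ h → ∨ₜ-least (below-either s s′ (h (hereᴸ refl))) (u-min s s′ (λ i → h (thereᴸ i)))
        where
        below-either : ∀ s s′ → (c ⊩ s) ⊎ (c ⊩ s′) → t ≤ₜ s ∨ₜ s′
        below-either s s′ (inj₁ q) = ≤ₜ-trans (t-min s q) (s≤s∨t s s′)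
        below-either s s′ (inj₂ q) = ≤ₜ-trans (t-min s′ q) (t≤s∨t s s′)

      -- Each cover contributes the join of the least terms of its members. That join is above `j`
      -- by `covers-sound`, and `⊩-∧` keeps the meet above `j`.
      ⋀-covers : ∀ j (t₀ : Term X) → j ⊩ t₀ → (Cs : List (List J)) →
        (∀ {C} → C ∈ᴸ Cs → C ∈ᴸ covers j) →
        (∀ {c} → c ≺ j → Least c) →
        ∃ λ t → j ⊩ t × t ≤ₜ t₀ × (∀ {C} → C ∈ᴸ Cs → BelowJoins t C)
      ⋀-covers j t₀ j⊩t₀ [] inc rec = t₀ , j⊩t₀ , ≤ₜ-refl , λ ()
      ⋀-covers j t₀ j⊩t₀ (C ∷ Cs) inc rec
        with ⋁-least C (λ i → rec (covers-≺ j (inc (hereᴸ refl)) i))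
           | ⋀-covers j t₀ j⊩t₀ Cs (λ i → inc (thereᴸ i)) rec
      ... | t , C⊩t , t-min | u , j⊩u , u≤t₀ , u-min =
        t ∧ₜ u
        , ⊩-∧ j t u (covers-sound j (inc (hereᴸ refl)) t C⊩t) j⊩u
        , ≤ₜ-trans (s∧t≤t t u) u≤t₀
        , λ { (hereᴸ refl) s s′ h → ≤ₜ-trans (s∧t≤s t u) (t-min s s′ h)
            ; (thereᴸ i)   s s′ h → ≤ₜ-trans (s∧t≤t t u) (u-min i s s′ h) }

      least-step : ∀ j → (∀ {c} → c ≺ j → Least c) → Least j
      least-step j rec = t , j⊩t , t-min
        where
        gens : List X
        gens = filter (⊩var? j) xs

        -- The default generator is itself above `j`, so it does not push the meet below `j`.
        t₀ : Term X
        t₀ = ⋀-vars (var (proj₁ (⊩var j))) gens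

        ⊩-⋀-vars : ∀ ys → (∀ {x} → x ∈ᴸ ys → j ⊩ var x) → j ⊩ ⋀-vars (var (proj₁ (⊩var j))) ys
        ⊩-⋀-vars [] h       = proj₂ (⊩var j)
        ⊩-⋀-vars (y ∷ ys) h = ⊩-∧ j _ _ (h (hereᴸ refl)) (⊩-⋀-vars ys (λ i → h (thereᴸ i)))

        meet = ⋀-covers j t₀ (⊩-⋀-vars gens (λ i → proj₂ (∈-filter⁻ (⊩var? j) {xs = xs} i)))
                 (covers j) (λ i → i) rec
        t = proj₁ meet
        j⊩t = proj₁ (proj₂ meet)
        t≤t₀ = proj₁ (proj₂ (proj₂ meet))
        t-below-covers = proj₂ (proj₂ (proj₂ meet))

        -- Induction on `s`. Generators are handled by `t₀`; a join needs the covers only when `j`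
        -- is below neither joinand.
        t-min : ∀ s → j ⊩ s → t ≤ₜ s
        t-min (var x) j⊩s =
          ≤ₜ-trans t≤t₀ (⋀-vars-lower _ (∈-filter⁺ (⊩var? j) (complete x) j⊩s))
        t-min (s ∧ₜ s′) j⊩s =
          ∧ₜ-greatest (t-min s (⊩-mono j (s∧t≤s s s′) j⊩s))
                      (t-min s′ (⊩-mono j (s∧t≤t s s′) j⊩s))
        t-min (s ∨ₜ s′) j⊩s with covers-complete j s s′ j⊩s
        ... | inj₁ q = ≤ₜ-trans (t-min s q) (s≤s∨t s s′)
        ... | inj₂ (inj₁ q) = ≤ₜ-trans (t-min s′ q) (t≤s∨t s s′)
        ... | inj₂ (inj₂ (C , C∈ , below)) = t-below-covers C∈ s s′ below

      least-term : ∀ j → Least j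
      least-term = All.wfRec ≺-wf 0ℓ Least least-step

      least-above : (C : List J) →
        ∃ λ t → (∀ {c} → c ∈ᴸ C → c ⊩ t) × (∀ s → (∀ {c} → c ∈ᴸ C → c ⊩ s) → t ≤ₜ s)
      least-above C with ⋁-least C (λ {c} _ → least-term c)
      ... | t , C⊩t , t-min = t , C⊩t , λ s C⊩s →
        -- `BelowJoins` with both sides equal to `s`, followed by `s ∨ₜ s ≤ₜ s`.
        ≤ₜ-trans (t-min s s (λ i → inj₁ (C⊩s i))) (∨ₜ-least ≤ₜ-refl ≤ₜ-refl)

-- Finite families of sets and closure under splits.

module ClosureSpace where

  open import Data.Nat using (zero; suc; _+_; _<_; _≤_; z≤n; _<?_; _≟_)
  open import Data.Nat.Properties using (≤-refl; <-≤-trans; <-trans; +-mono-≤; +-mono-<-≤; +-mono-≤-<; ≤-pred; n<1+n)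
  open import Data.Nat.Induction using (<-wellFounded)
  open import Data.Bool using (Bool; true; false; T)
  import Data.Bool.Properties as Bool
  open import Data.Unit using (tt)
  open import Data.Empty using (⊥-elim)
  open import Data.Fin.Subset using (Subset; ∣_∣)
  open import Data.Fin.Subset.Properties using (anySubset?)
  open import Data.Vec using ([]; _∷_)
  open import Data.Vec.Properties using (≡-dec)
  open import Data.Product using (∃; _×_; _,_; proj₁; proj₂)
  open import Data.Product.Relation.Binary.Lex.Strict using (×-Lex; ×-wellFounded; ×-decidable)
  open import Data.Sum using (_⊎_; inj₁; inj₂; [_,_]′)
  open import Data.List using (List; []; _∷_; cartesianProduct; cartesianProductWith)
  open import Data.List.Membership.Propositional using () renaming (_∈_ to _∈ᴸ_)
  open import Data.List.Membership.Propositional.Properties using (∈-cartesianProduct⁺; ∈-cartesianProductWith⁺)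
  open import Data.List.Relation.Unary.Any using () renaming (here to hereᴸ; there to thereᴸ)
  open import Function using (_∘_; _on_)
  open import Induction.WellFounded using (WellFounded)
  open import Level using (0ℓ)
  open import Relation.Binary using (Rel)
  import Relation.Binary.Construct.On as On
  open import Relation.Binary.PropositionalEquality using (_≡_; refl; sym; subst)
  open import Relation.Nullary using (Dec; yes; no; ¬_; ⌊_⌋; ¬?; _×-dec_; _⊎-dec_)
  open import Relation.Nullary.Decidable using (toWitness; fromWitness; decidable-stable; map′)
  open import Relation.Unary using (_⊆_; Decidable; _∪_; _∩_)
  open import Relation.Unary.Properties using (_∩?_; ∁?)

  -- Families of subsets of Fin n as binary tries, so that they can be listed
  -- and are determined by their members.
  Fam : ℕ → Set
  Fam zero    = Bool
  Fam (suc n) = Fam n × Fam n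

  member : ∀ {n} → Fam n → Subset n → Bool
  member {zero}  b       []          = b
  member {suc n} (f , g) (true ∷ X)  = member f X
  member {suc n} (f , g) (false ∷ X) = member g X

  ⟦_⟧ : ∀ {n} → Fam n → Pred n
  ⟦ F ⟧ X = T (member F X)

  tabulate : ∀ {n} → (Subset n → Bool) → Fam n
  tabulate {zero}  h = h []
  tabulate {suc n} h = tabulate (h ∘ (true ∷_)) , tabulate (h ∘ (false ∷_))

  member-tabulate : ∀ {n} (h : Subset n → Bool) X → member (tabulate h) X ≡ h X
  member-tabulate {zero}  h []          = refl
  member-tabulate {suc n} h (true ∷ X)  = member-tabulate (h ∘ (true ∷_)) X
  member-tabulate {suc n} h (false ∷ X) = member-tabulate (h ∘ (false ∷_)) X

  ⟦_⟧? : ∀ {n} (F : Fam n) → Decidable ⟦ F ⟧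
  ⟦ F ⟧? X with member F X
  ... | true  = yes tt
  ... | false = no λ ()

  fam : ∀ {n} {P : Pred n} → Decidable P → Fam n
  fam P? = tabulate (λ X → ⌊ P? X ⌋)

  module _ {n : ℕ} {P : Pred n} (P? : Decidable P) where

    fam⁺ : P ⊆ ⟦ fam P? ⟧
    fam⁺ {X} p = subst T (sym (member-tabulate (λ X → ⌊ P? X ⌋) X)) (fromWitness {a? = P? X} p)

    fam⁻ : ⟦ fam P? ⟧ ⊆ P
    fam⁻ {X} p = toWitness {a? = P? X} (subst T (member-tabulate (λ X → ⌊ P? X ⌋) X) p)

  allFams : ∀ n → List (Fam n)
  allFams zero    = true ∷ false ∷ []
  allFams (suc n) = cartesianProductWith _,_ (allFams n) (allFams n)

  allFams-complete : ∀ n (F : Fam n) → F ∈ᴸ allFams n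
  allFams-complete zero    true    = hereᴸ refl
  allFams-complete zero    false   = thereᴸ (hereᴸ refl)
  allFams-complete (suc n) (f , g) =
    ∈-cartesianProductWith⁺ _,_ (allFams-complete n f) (allFams-complete n g)

  allSubsets : ∀ n → List (Subset n)
  allSubsets zero    = [] ∷ []
  allSubsets (suc n) = cartesianProductWith _∷_ (true ∷ false ∷ []) (allSubsets n)

  allSubsets-complete : ∀ n (X : Subset n) → X ∈ᴸ allSubsets n
  allSubsets-complete zero    []      = hereᴸ refl
  allSubsets-complete (suc n) (b ∷ X) =
    ∈-cartesianProductWith⁺ _∷_ (allFams-complete 0 b) (allSubsets-complete n X)

  size : ∀ {n} → Fam n → ℕ
  size {zero}  true    = 1
  size {zero}  false   = 0
  size {suc n} (f , g) = size f + size g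

  size-⊆ : ∀ {n} (F G : Fam n) → ⟦ F ⟧ ⊆ ⟦ G ⟧ → size F ≤ size G
  size-⊆ {zero}  false G     h = z≤n
  size-⊆ {zero}  true  true  h = ≤-refl
  size-⊆ {zero}  true  false h = ⊥-elim (h {[]} tt)
  size-⊆ {suc n} (f , g) (f′ , g′) h =
    +-mono-≤ (size-⊆ f f′ (λ {X} → h {true ∷ X})) (size-⊆ g g′ (λ {X} → h {false ∷ X}))

  -- An inclusion either raises the size or is an equality; this yields the descent among
  -- neighbourhoods with a common apex.
  size-⊂ : ∀ {n} (F G : Fam n) → ⟦ F ⟧ ⊆ ⟦ G ⟧ → size F < size G ⊎ ⟦ G ⟧ ⊆ ⟦ F ⟧
  size-⊂ {zero} F     false h = inj₂ λ { {[]} () }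
  size-⊂ {zero} true  true  h = inj₂ λ { {[]} _ → tt }
  size-⊂ {zero} false true  h = inj₁ ≤-refl
  size-⊂ {suc n} (f , g) (f′ , g′) h
    with size-⊂ f f′ (λ {X} → h {true ∷ X}) | size-⊂ g g′ (λ {X} → h {false ∷ X})
  ... | inj₁ lt | _ = inj₁ (+-mono-<-≤ lt (size-⊆ g g′ (λ {X} → h {false ∷ X})))
  ... | inj₂ _  | inj₁ lt = inj₁ (+-mono-≤-< (size-⊆ f f′ (λ {X} → h {true ∷ X})) lt)
  ... | inj₂ p  | inj₂ q = inj₂ λ { {true ∷ X} → p {X} ; {false ∷ X} → q {X} }

  abstract
    _⊆?_ : ∀ {n} {P Q : Pred n} → Decidable P → Decidable Q → Dec (P ⊆ Q)
    _⊆?_ {P = P} {Q} P? Q? with anySubset? (P? ∩? ∁? Q?)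
    ... | yes (X , p , ¬q) = no λ h → ¬q (h p)
    ... | no none = yes λ {X} p → decidable-stable (Q? X) (λ ¬q → none (X , p , ¬q))

  -- Split X Y Z abstracts "X, Y, Z are connected and X is the disjoint union of
  -- Y and Z"; connectedness enters through split-assoc only.
  module SplitClosure {n : ℕ} (InC : Pred n) (InC? : Decidable InC)
    (Split : Subset n → Subset n → Subset n → Set)
    (Split? : ∀ X Y Z → Dec (Split X Y Z))
    (split-inC : ∀ {X Y Z} → Split X Y Z → InC X × InC Y)
    (split-comm : ∀ {X Y Z} → Split X Y Z → Split X Z Y)
    (split-< : ∀ {X Y Z} → Split X Y Z → ∣ Y ∣ < ∣ X ∣)
    (split-assoc : ∀ {X Y Z Z₁ Z₂} → Split X Y Z → Split Z Z₁ Z₂ →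
       ∃ λ W → (Split W Y Z₁ × Split X W Z₂) ⊎ (Split W Y Z₂ × Split X W Z₁))
    where

    -- Gluing two pieces at a time replaces unions of arbitrary finite partitions; `φ⇒Cl` and `Cl⇒φ`
    -- show that nothing changes for sets of connected subsets.
    data Cl (x : Pred n) : Pred n where
      base : ∀ {X} → x X → Cl x X
      node : ∀ {X Y Z} → Split X Y Z → Cl x Y → Cl x Z → Cl x X

    ∁ : Pred n → Pred n
    ∁ x X = InC X × ¬ x X

    Int : Pred n → Pred n
    Int x = ∁ (Cl (∁ x))

    -- `Open` is the contrapositive of closedness of the complement, stated positively; `∁-open` and
    -- `∁-closed` pass between the two.
    Closed Open : Pred n → Set
    Closed z = ∀ {X Y Z} → Split X Y Z → z Y → z Z → z X
    Open u = ∀ {X Y Z} → Split X Y Z → u X → u Y ⊎ u Z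

    split-inC₂ : ∀ {X Y Z} → Split X Y Z → InC Z
    split-inC₂ s = proj₂ (split-inC (split-comm s))

    Cl-closed : ∀ {x} → Closed (Cl x)
    Cl-closed = node

    Cl-least : ∀ {x z} → x ⊆ z → Closed z → Cl x ⊆ z
    Cl-least x⊆z closed (base p)     = x⊆z p
    Cl-least x⊆z closed (node s p q) = closed s (Cl-least x⊆z closed p) (Cl-least x⊆z closed q)

    Cl-mono : ∀ {x y} → x ⊆ y → Cl x ⊆ Cl y
    Cl-mono x⊆y = Cl-least (base ∘ x⊆y) Cl-closed

    Cl-inC : ∀ {x} → x ⊆ InC → Cl x ⊆ InC
    Cl-inC x⊆C = Cl-least x⊆C (λ s _ _ → proj₁ (split-inC s))

    ∁-anti : ∀ {x y} → x ⊆ y → ∁ y ⊆ ∁ x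
    ∁-anti x⊆y (c , ¬y) = c , ¬y ∘ x⊆y

    Int-mono : ∀ {x y} → x ⊆ y → Int x ⊆ Int y
    Int-mono {x} {y} x⊆y =
      ∁-anti {Cl (∁ y)} {Cl (∁ x)} (Cl-mono {∁ y} {∁ x} (∁-anti {x} {y} x⊆y))

    ∁-dec : ∀ {x} → Decidable x → Decidable (∁ x)
    ∁-dec x? X = InC? X ×-dec ¬? (x? X)

    abstract
      -- Both parts of a split are smaller than the whole, so a search through all splits ends; the
      -- fuel always exceeds the cardinality.
      Cl? : ∀ {x} → Decidable x → Decidable (Cl x)
      Cl? {x} x? X = search (suc ∣ X ∣) X (n<1+n _)
        where
        search : ∀ m X → ∣ X ∣ < m → Dec (Cl x X)
        search (suc m) X X<m with x? X | anySubset? (λ Y → anySubset? (λ Z → split? Y Z))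
          where
          split? : ∀ Y Z → Dec (Split X Y Z × Cl x Y × Cl x Z)
          split? Y Z with Split? X Y Z
          ... | no ¬s = no (¬s ∘ proj₁)
          ... | yes s = map′ (s ,_) proj₂
            (search m Y (<-≤-trans (split-< s) (≤-pred X<m))
              ×-dec search m Z (<-≤-trans (split-< (split-comm s)) (≤-pred X<m)))
        ... | yes p | _                        = yes (base p)
        ... | no _  | yes (Y , Z , s , p , q) = yes (node s p q)
        ... | no ¬p | no ¬s                    = no λ { (base p)     → ¬p p
                                                      ; (node s p q) → ¬s (_ , _ , s , p , q) }

    Int? : ∀ {x} → Decidable x → Decidable (Int x)
    Int? x? = ∁-dec (Cl? (∁-dec x?))

    Int-open : ∀ {x} → Decidable x → Open (Int x)
    Int-open x? {X} {Y} {Z} s (_ , ¬p) with Cl? (∁-dec x?) Y | Cl? (∁-dec x?) Z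
    ... | no ¬q | _     = inj₁ (proj₂ (split-inC s) , ¬q)
    ... | yes _ | no ¬r = inj₂ (split-inC₂ s , ¬r)
    ... | yes q | yes r = ⊥-elim (¬p (node s q r))

    Int⊆ : ∀ {x} → Decidable x → Int x ⊆ x
    Int⊆ x? {X} (c , ¬p) = decidable-stable (x? X) (λ ¬x → ¬p (base (c , ¬x)))

    -- By induction on generation, an open set that misses `∁ x` misses all of `Cl (∁ x)`.
    ⊆Int : ∀ {u x} → u ⊆ InC → Open u → u ⊆ x → u ⊆ Int x
    ⊆Int {u} {x} u⊆C open-u u⊆x {X} p = u⊆C p , λ q → misses q p
      where
      misses : ∀ {X} → Cl (∁ x) X → ¬ u X
      misses (base (_ , ¬x)) p = ¬x (u⊆x p)
      misses (node s q r)    p = [ misses q , misses r ]′ (open-u s p)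

    ∁-open : ∀ {z} → Decidable z → Closed z → Open (∁ z)
    ∁-open z? closed {X} {Y} {Z} s (_ , ¬p) with z? Y | z? Z
    ... | no ¬q | _     = inj₁ (proj₂ (split-inC s) , ¬q)
    ... | yes _ | no ¬r = inj₂ (split-inC₂ s , ¬r)
    ... | yes q | yes r = ⊥-elim (¬p (closed s q r))

    ∪-open : ∀ {u v} → Open u → Open v → Open (u ∪ v)
    ∪-open open-u open-v s (inj₁ p) = [ inj₁ ∘ inj₁ , inj₂ ∘ inj₁ ]′ (open-u s p)
    ∪-open open-u open-v s (inj₂ p) = [ inj₁ ∘ inj₂ , inj₂ ∘ inj₂ ]′ (open-v s p)

    ∁-closed : ∀ {u} → Open u → Closed (∁ u)
    ∁-closed open-u s (_ , ¬p) (_ , ¬q) =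
      proj₁ (split-inC s) , λ r → [ ¬p , ¬q ]′ (open-u s r)

    _△_ : Pred n → Pred n → Pred n
    (z₁ △ z₂) X = z₁ X × ¬ z₂ X ⊎ z₂ X × ¬ z₁ X

    module _ {z₁ z₂ : Pred n} (z₁? : Decidable z₁) (z₂? : Decidable z₂)
      (closed₁ : Closed z₁) (closed₂ : Closed z₂) where

      private
        W : Pred n
        W = (z₁ ∩ z₂) ∪ Cl (z₁ △ z₂)

        classify : z₁ ∪ z₂ ⊆ W
        classify {X} p with z₁? X | z₂? X
        ... | yes a | yes b = inj₁ (a , b)
        ... | yes a | no ¬b = inj₂ (base (inj₁ (a , ¬b)))
        ... | no ¬a | yes b = inj₂ (base (inj₂ (b , ¬a)))
        ... | no ¬a | no ¬b = ⊥-elim ([ ¬a , ¬b ]′ p)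

        -- A piece in both sets is glued to an adjacent piece of the other part
        -- until none is left or everything is absorbed.
        absorb : ∀ {X Y Z} → Split X Y Z → (z₁ ∩ z₂) Y → Cl (z₁ △ z₂) Z → W X
        absorb s (a , b) (base (inj₁ (c , _))) = classify (inj₁ (closed₁ s a c))
        absorb s (a , b) (base (inj₂ (c , _))) = classify (inj₂ (closed₂ s b c))
        absorb s ab (node s′ q r) with split-assoc s s′
        ... | _ , inj₁ (t , t′) with absorb t ab q
        ...   | inj₁ ab′ = absorb t′ ab′ r
        ...   | inj₂ p   = inj₂ (node t′ p r)
        absorb s ab (node s′ q r) | _ , inj₂ (t , t′) with absorb t ab r
        ...   | inj₁ ab′ = absorb t′ ab′ q
        ...   | inj₂ p   = inj₂ (node t′ p q)

      -- It suffices that the right-hand side is closed. The only hard case glues a member of the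
      -- intersection to one generated by the symmetric difference, which is `absorb`.
      Cl-∪⊆∩∪Cl-△ : Cl (z₁ ∪ z₂) ⊆ (z₁ ∩ z₂) ∪ Cl (z₁ △ z₂)
      Cl-∪⊆∩∪Cl-△ = Cl-least classify λ
        { s (inj₁ (a , b)) (inj₁ (a′ , b′)) → inj₁ (closed₁ s a a′ , closed₂ s b b′)
        ; s (inj₁ ab)      (inj₂ p)         → absorb s ab p
        ; s (inj₂ p)       (inj₁ ab)        → absorb (split-comm s) ab p
        ; s (inj₂ p)       (inj₂ q)         → inj₂ (node s p q) }

    -- Neighbourhoods and the refinement of their covers.

    module _ {x y : Pred n} {p : Subset n} (closed : Closed y)
      (below : ∀ {q} → x q → ∣ q ∣ < ∣ p ∣ → y q) where

      Cl-below : ∀ {q} → Cl x q → ∣ q ∣ < ∣ p ∣ → y q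
      Cl-below (base a)     lt = below a lt
      Cl-below (node s a b) lt =
        closed s (Cl-below a (<-trans (split-< s) lt))
                 (Cl-below b (<-trans (split-< (split-comm s)) lt))

      -- Either `p` is a generator, or its topmost split has two smaller parts, to which `Cl-below`
      -- applies.
      Cl-at : Cl x p → x p ⊎ y p
      Cl-at (base a)     = inj₁ a
      Cl-at (node s a b) =
        inj₂ (closed s (Cl-below a (split-< s)) (Cl-below b (split-< (split-comm s))))

    ↓ : Subset n → Pred n
    ↓ p q = q ≡ p ⊎ ∣ q ∣ < ∣ p ∣

    ↓-open : ∀ {u} p → Open u → Open (u ∩ ↓ p)
    ↓-open {u} p open-u {X} {Y} {Z} s (a , X≤p) =
      [ (λ b → inj₁ (b , inj₂ (smaller s X≤p)))
      , (λ b → inj₂ (b , inj₂ (smaller (split-comm s) X≤p))) ]′ (open-u s a)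
      where
      smaller : ∀ {Y Z} → Split X Y Z → ↓ p X → ∣ Y ∣ < ∣ p ∣
      smaller s (inj₁ refl) = split-< s
      smaller s (inj₂ lt)   = <-trans (split-< s) lt

    ↓? : ∀ p → Decidable (↓ p)
    ↓? p q = ≡-dec Bool._≟_ q p ⊎-dec ∣ q ∣ <? ∣ p ∣

    Nbhd : Set
    Nbhd = Subset n × Fam n

    -- The interior makes every pair the code of an open set. The apex `p` need not be a member.
    nbhd : Nbhd → Pred n
    nbhd (p , F) = Int (⟦ F ⟧ ∩ ↓ p)

    nbhd? : ∀ j → Decidable (nbhd j)
    nbhd? (p , F) = Int? (⟦ F ⟧? ∩? ↓? p)

    nbhd-open : ∀ j → Open (nbhd j)
    nbhd-open (p , F) = Int-open (⟦ F ⟧? ∩? ↓? p)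

    nbhd-↓ : ∀ j → nbhd j ⊆ ↓ (proj₁ j)
    nbhd-↓ (p , F) {q} i = proj₂ (Int⊆ (⟦ F ⟧? ∩? ↓? p) i)

    nbhd-inC : ∀ j → nbhd j ⊆ InC
    nbhd-inC j = proj₁

    allNbhds : List Nbhd
    allNbhds = cartesianProduct (allSubsets n) (allFams n)

    allNbhds-complete : ∀ j → j ∈ᴸ allNbhds
    allNbhds-complete (p , F) =
      ∈-cartesianProduct⁺ (allSubsets-complete n p) (allFams-complete n F)

    module _ {u : Pred n} (u? : Decidable u) (p : Subset n) where

      at : Nbhd
      at = p , fam (u? ∩? ↓? p)

      at⁻ : nbhd at ⊆ u
      at⁻ i = proj₁ (fam⁻ (u? ∩? ↓? p) (proj₁ (Int⊆ (⟦ proj₂ at ⟧? ∩? ↓? p) i)))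

      -- The interior loses nothing here, as `u ∩ ↓ p` is already open.
      at⁺ : u ⊆ InC → Open u → u ∩ ↓ p ⊆ nbhd at
      at⁺ u⊆C open-u = ⊆Int (u⊆C ∘ proj₁) (↓-open p open-u)
        (λ { (i , q≤p) → fam⁺ (u? ∩? ↓? p) (i , q≤p) , q≤p })

    -- The second component counts the members of the neighbourhood, not of the coding family, as
    -- several families may code the same neighbourhood.
    rank : Nbhd → ℕ × ℕ
    rank j = ∣ proj₁ j ∣ , size (fam (nbhd? j))

    _≺_ : Rel Nbhd 0ℓ
    _≺_ = ×-Lex _≡_ _<_ _<_ on rank

    abstract
      ≺-wellFounded : WellFounded _≺_
      ≺-wellFounded = On.wellFounded rank (×-wellFounded <-wellFounded <-wellFounded)

      _≺?_ : ∀ i j → Dec (i ≺ j)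
      i ≺? j = ×-decidable _≟_ _<?_ _<?_ (rank i) (rank j)

    ≺-shrink : ∀ i j → proj₁ i ≡ proj₁ j → nbhd i ⊆ nbhd j → i ≺ j ⊎ nbhd j ⊆ nbhd i
    ≺-shrink i j refl i⊆j
      with size-⊂ (fam (nbhd? i)) (fam (nbhd? j)) (fam⁺ (nbhd? j) ∘ i⊆j ∘ fam⁻ (nbhd? i))
    ... | inj₁ lt  = inj₁ (inj₂ (refl , lt))
    ... | inj₂ j⊆i = inj₂ (fam⁻ (nbhd? i) ∘ j⊆i ∘ fam⁺ (nbhd? j))

    module _ (j : Nbhd) {b c : Pred n} (b? : Decidable b) (c? : Decidable c)
      (b⊆C : b ⊆ InC) (c⊆C : c ⊆ InC) (open-b : Open b) (open-c : Open c)
      (j⊆b∨c : nbhd j ⊆ Cl (b ∪ c)) {y : Pred n} (closed : Closed y)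
      (lower⊆y : ∀ i → i ≺ j → nbhd i ⊆ b ⊎ nbhd i ⊆ c → nbhd i ⊆ y) where

      private
        p = proj₁ j

        -- Such a `q` is the apex of a neighbourhood inside its own side, lower than `j` by the
        -- first component of `rank`.
        smaller : ∀ {q} → (b ∪ c) q → ∣ q ∣ < ∣ p ∣ → y q
        smaller {q} (inj₁ i) lt =
          lower⊆y (at b? q) (inj₁ lt) (inj₁ (at⁻ b? q)) (at⁺ b? q b⊆C open-b (i , inj₁ refl))
        smaller {q} (inj₂ i) lt =
          lower⊆y (at c? q) (inj₁ lt) (inj₂ (at⁻ c? q)) (at⁺ c? q c⊆C open-c (i , inj₁ refl))

        -- If p lies in the open part d of one side, either the interior of
        -- nbhd j ∩ d is a smaller neighbourhood of p, or p is obtained from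
        -- smaller members of nbhd j and d by Cl-∪⊆∩∪Cl-△.
        apex : ∀ {d} → Decidable d → Open d → d ⊆ b ∪ c → ¬ (nbhd j ⊆ d) →
          (∀ {i} → nbhd i ⊆ d → nbhd i ⊆ b ⊎ nbhd i ⊆ c) → nbhd j p → d p → y p
        apex {d} d? open-d d⊆ j⊈d side j∋p d∋p with Int? (nbhd? j ∩? d?) p
        ... | yes i∋p = lower⊆y i i≺j (side i⊆d) p∈i
          where
          v? = Int? (nbhd? j ∩? d?)
          i = at v? p
          i⊆v : nbhd i ⊆ nbhd j ∩ d
          i⊆v = Int⊆ (nbhd? j ∩? d?) ∘ at⁻ v? p
          i⊆d : nbhd i ⊆ d
          i⊆d = proj₂ ∘ i⊆v
          p∈i : nbhd i p
          p∈i = at⁺ v? p proj₁ (Int-open (nbhd? j ∩? d?)) (i∋p , inj₁ refl)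
          i≺j : i ≺ j
          i≺j with ≺-shrink i j refl (proj₁ ∘ i⊆v)
          ... | inj₁ lt  = lt
          ... | inj₂ j⊆i = ⊥-elim (j⊈d (i⊆d ∘ j⊆i))
        ... | no i∌p
          with Cl-∪⊆∩∪Cl-△ (∁-dec (nbhd? j)) (∁-dec d?) (∁-closed (nbhd-open j)) (∁-closed open-d)
                 (Cl-mono complement-∩ p∈Cl)
          where
          p∈Cl : Cl (∁ (nbhd j ∩ d)) p
          p∈Cl = decidable-stable (Cl? (∁-dec (nbhd? j ∩? d?)) p)
                   (λ ¬p → i∌p (nbhd-inC j j∋p , ¬p))
          complement-∩ : ∁ (nbhd j ∩ d) ⊆ ∁ (nbhd j) ∪ ∁ d
          complement-∩ {q} (c , ¬q) with nbhd? j q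
          ... | yes j∋q = inj₂ (c , λ d∋q → ¬q (j∋q , d∋q))
          ... | no j∌q  = inj₁ (c , j∌q)
        ...   | inj₁ ((_ , j∌p) , _) = ⊥-elim (j∌p j∋p)
        ...   | inj₂ p∈△ with Cl-at closed below p∈△
          where
          -- A member of the symmetric difference lies in exactly one of `nbhd j` and `d`. In `d` it
          -- belongs to `b ∪ c`; in `nbhd j` it is generated by members of `b ∪ c`, all smaller than
          -- `p`.
          below : ∀ {q} → (∁ (nbhd j) △ ∁ d) q → ∣ q ∣ < ∣ p ∣ → y q
          below {q} (inj₁ ((c , _) , ¬d)) lt =
            smaller (d⊆ (decidable-stable (d? q) (λ ¬q → ¬d (c , ¬q)))) lt
          below {q} (inj₂ ((c , _) , ¬j)) lt =
            Cl-below {p = p} closed smaller (j⊆b∨c (decidable-stable (nbhd? j q) (λ ¬q → ¬j (c , ¬q)))) lt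
        ...     | inj₁ (inj₁ ((_ , j∌p) , _)) = ⊥-elim (j∌p j∋p)
        ...     | inj₁ (inj₂ ((_ , d∌p) , _)) = ⊥-elim (d∌p d∋p)
        ...     | inj₂ y∋p = y∋p

      -- Members smaller than `p` are generated by smaller members of `b ∪ c`, which lie in `y`.
      -- Only an apex that itself belongs to `b` or `c` needs `apex`. As `y` is any closed set above
      -- the lower neighbourhoods, these cover `nbhd j`.
      nbhd-cover : ¬ (nbhd j ⊆ b) → ¬ (nbhd j ⊆ c) → nbhd j ⊆ y
      nbhd-cover j⊈b j⊈c {q} j∋q with nbhd-↓ j j∋q
      ... | inj₂ lt = Cl-below {p = p} closed smaller (j⊆b∨c j∋q) lt
      ... | inj₁ refl with Cl-at closed smaller (j⊆b∨c j∋q)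
      ...   | inj₂ y∋p        = y∋p
      ...   | inj₁ (inj₁ b∋p) = apex b? open-b inj₁ j⊈b inj₁ j∋q b∋p
      ...   | inj₁ (inj₂ c∋p) = apex c? open-c inj₂ j⊈c inj₂ j∋q c∋p

-- Connected subsets of a graph and their splits.

module GraphClosure where

  open ClosureSpace using (module SplitClosure)
  open import Data.Nat using (ℕ; suc; _<_; _≤_)
  open import Data.Nat.Properties using (≤-reflexive; ≤-trans; ≤-pred; <-≤-trans; n<1+n)
  open import Data.Bool using (Bool; T; T?)
  import Data.Bool.Properties as Bool
  open import Data.Empty using (⊥-elim)
  open import Data.Fin using (Fin)
  open import Data.Fin.Properties using (any?; all?)
  open import Data.Fin.Subset using (Subset; _∈_; _∉_; _⊆_; _∩_; _∪_; ∁; ⁅_⁆; ∣_∣; Nonempty)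
  open import Data.Fin.Subset.Properties
  open import Data.Vec.Properties using (≡-dec)
  open import Data.Product using (∃; _×_; _,_; proj₁; proj₂)
  open import Data.Sum using (_⊎_; inj₁; inj₂; [_,_]′)
  open import Data.List using (List; []; _∷_; _++_; length)
  open import Data.List.Properties using (++-conicalˡ)
  open import Data.List.Relation.Unary.All as All using (All; []; _∷_)
  open import Data.List.Relation.Unary.AllPairs using (AllPairs; []; _∷_)
  import Data.List.Relation.Unary.All.Properties as All
  import Data.List.Relation.Unary.AllPairs.Properties as AllPairs
  import Data.List.Relation.Binary.Permutation.Propositional as ↭
  open import Data.List.Relation.Binary.Permutation.Propositional using (_↭_)
  open import Data.List.Relation.Binary.Permutation.Propositional.Properties using (All-resp-↭; ↭-length)
  open import Relation.Unary using (Decidable) renaming (_⊆_ to _⊑_)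
  open import Relation.Binary.PropositionalEquality using (_≡_; refl; sym; trans; cong; subst; module ≡-Reasoning)
  open import Relation.Nullary using (Dec; yes; no; ¬?; _×-dec_; _→-dec_)
  open import Function using (_∘_)

  module _ {n : ℕ} (G : Graph n) where

    disjoint⁺ : ∀ {Y Z} → (∀ {i} → i ∈ Y → i ∉ Z) → Disjoint G Y Z
    disjoint⁺ {Y} {Z} h (i , i∈) with x∈p∩q⁻ Y Z i∈
    ... | i∈Y , i∈Z = h i∈Y i∈Z

    disjoint⁻ : ∀ {Y Z} → Disjoint G Y Z → ∀ {i} → i ∈ Y → i ∉ Z
    disjoint⁻ d i∈Y i∈Z = d (_ , x∈p∩q⁺ (i∈Y , i∈Z))

    disjoint-sym : ∀ {Y Z} → Disjoint G Y Z → Disjoint G Z Y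
    disjoint-sym d = disjoint⁺ λ i∈Z i∈Y → disjoint⁻ d i∈Y i∈Z

    path-mono : ∀ {X Y u v} → X ⊆ Y → PathIn G X u v → PathIn G Y u v
    path-mono X⊆Y (here p)     = here (X⊆Y p)
    path-mono X⊆Y (step p a r) = step (X⊆Y p) a (path-mono X⊆Y r)

    path-concat : ∀ {X u v w} → PathIn G X u v → PathIn G X v w → PathIn G X u w
    path-concat (here _)     s = s
    path-concat (step p a r) s = step p a (path-concat r s)

    path-start : ∀ {X u v} → PathIn G X u v → u ∈ X
    path-start (here p)     = p
    path-start (step p _ _) = p

    adj-sym′ : ∀ {u v} → T (adj G u v) → T (adj G v u)
    adj-sym′ {u} {v} = subst T (adj-sym G u v)

    path-edge : ∀ {X u v w} → PathIn G X u v → T (adj G v w) → w ∈ X → PathIn G X u w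
    path-edge (here p)     a q = step p a (here q)
    path-edge (step p b r) a q = step p b (path-edge r a q)

    -- The witness is the first edge of the path that leaves `Y`.
    crossing : ∀ {X u v} (Y : Subset n) → PathIn G X u v → u ∈ Y → v ∉ Y →
      ∃ λ a → ∃ λ b → a ∈ Y × b ∈ X × b ∉ Y × T (adj G a b)
    crossing Y (here _) u∈Y v∉Y = ⊥-elim (v∉Y u∈Y)
    crossing Y (step {u} {w} _ a r) u∈Y v∉Y with w ∈? Y
    ... | yes w∈Y = crossing Y r w∈Y v∉Y
    ... | no w∉Y  = u , w , u∈Y , path-start r , w∉Y , a

    connected-∪ : ∀ {Y Z a b} → InC G Y → InC G Z → a ∈ Y → b ∈ Z → T (adj G a b) → InC G (Y ∪ Z)
    connected-∪ {Y} {Z} {a} {b} ((y , y∈Y) , pY) (_ , pZ) a∈Y b∈Z e =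
      (y , Y⊆ y∈Y) , λ u v u∈ v∈ → link u v (x∈p∪q⁻ Y Z u∈) (x∈p∪q⁻ Y Z v∈)
      where
      Y⊆ : Y ⊆ Y ∪ Z
      Y⊆ = p⊆p∪q Z
      Z⊆ : Z ⊆ Y ∪ Z
      Z⊆ = q⊆p∪q Y Z
      inY : ∀ {u v} → u ∈ Y → v ∈ Y → PathIn G (Y ∪ Z) u v
      inY p q = path-mono Y⊆ (pY _ _ p q)
      inZ : ∀ {u v} → u ∈ Z → v ∈ Z → PathIn G (Y ∪ Z) u v
      inZ p q = path-mono Z⊆ (pZ _ _ p q)
      link : ∀ u v → u ∈ Y ⊎ u ∈ Z → v ∈ Y ⊎ v ∈ Z → PathIn G (Y ∪ Z) u v
      link u v (inj₁ p) (inj₁ q) = inY p q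
      link u v (inj₂ p) (inj₂ q) = inZ p q
      link u v (inj₁ p) (inj₂ q) =
        path-concat (inY p a∈Y) (step (Y⊆ a∈Y) e (inZ b∈Z q))
      link u v (inj₂ p) (inj₁ q) =
        path-concat (inZ p b∈Z) (step (Z⊆ b∈Z) (adj-sym′ e) (inY a∈Y q))

    -- Vertices of `X` adjacent to the set are added one by one, so its complement shrinks. Once
    -- none is left, `crossing` shows that no path from `u` leaves the set.
    reachable : ∀ X u → u ∈ X →
      ∃ λ S → (∀ {v} → v ∈ S → PathIn G X u v) × (∀ {v} → PathIn G X u v → v ∈ S)
    reachable X u u∈X = grow (suc ∣ ∁ ⁅ u ⁆ ∣) ⁅ u ⁆ (n<1+n _) (x∈⁅x⁆ u)
      λ v∈ → subst (PathIn G X u) (sym (x∈⁅y⁆⇒x≡y u v∈)) (here u∈X)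
      where
      grow : ∀ m S → ∣ ∁ S ∣ < m → u ∈ S → (∀ {v} → v ∈ S → PathIn G X u v) →
        ∃ λ S → (∀ {v} → v ∈ S → PathIn G X u v) × (∀ {v} → PathIn G X u v → v ∈ S)
      grow (suc m) S S<m u∈S sound
        with any? (λ a → any? (λ b → a ∈? S ×-dec b ∈? X ×-dec ¬? (b ∈? S) ×-dec T? (adj G a b)))
      ... | no none = S , sound , complete
        where
        complete : ∀ {v} → PathIn G X u v → v ∈ S
        complete {v} r with v ∈? S
        ... | yes v∈S = v∈S
        ... | no v∉S  = ⊥-elim (none (crossing S r u∈S v∉S))
      ... | yes (a , b , a∈S , b∈X , b∉S , e) =
        grow m (S ∪ ⁅ b ⁆) (<-≤-trans smaller (≤-pred S<m)) (p⊆p∪q ⁅ b ⁆ u∈S) sound′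
        where
        smaller : ∣ ∁ (S ∪ ⁅ b ⁆) ∣ < ∣ ∁ S ∣
        smaller = p⊂q⇒∣p∣<∣q∣ (p⊂q⇒∁p⊃∁q
          (p⊆p∪q ⁅ b ⁆ , b , q⊆p∪q S ⁅ b ⁆ (x∈⁅x⁆ b) , b∉S))
        sound′ : ∀ {v} → v ∈ S ∪ ⁅ b ⁆ → PathIn G X u v
        sound′ v∈ with x∈p∪q⁻ S ⁅ b ⁆ v∈
        ... | inj₁ v∈S = sound v∈S
        ... | inj₂ v∈b = subst (PathIn G X u) (sym (x∈⁅y⁆⇒x≡y b v∈b)) (path-edge (sound a∈S) e b∈X)

    path? : ∀ X u v → Dec (PathIn G X u v)
    path? X u v with u ∈? X
    ... | no u∉X = no (u∉X ∘ path-start)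
    ... | yes u∈X with reachable X u u∈X
    ...   | S , sound , complete with v ∈? S
    ...     | yes v∈S = yes (sound v∈S)
    ...     | no v∉S  = no (v∉S ∘ complete)

    abstract
      InC? : Decidable (InC G)
      InC? X = nonempty? X ×-dec
        all? (λ u → all? (λ v → u ∈? X →-dec (v ∈? X →-dec path? X u v)))

    Split : Subset n → Subset n → Subset n → Set
    Split X Y Z = InC G X × InC G Y × InC G Z × Disjoint G Y Z × Y ∪ Z ≡ X

    abstract
      Split? : ∀ X Y Z → Dec (Split X Y Z)
      Split? X Y Z = InC? X ×-dec InC? Y ×-dec InC? Z
        ×-dec ¬? (nonempty? (Y ∩ Z)) ×-dec ≡-dec Bool._≟_ (Y ∪ Z) X

    split-inC : ∀ {X Y Z} → Split X Y Z → InC G X × InC G Y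
    split-inC (x , y , _) = x , y

    split-comm : ∀ {X Y Z} → Split X Y Z → Split X Z Y
    split-comm {_} {Y} {Z} (x , y , z , d , eq) =
      x , z , y , disjoint-sym d , trans (∪-comm Z Y) eq

    split-< : ∀ {X Y Z} → Split X Y Z → ∣ Y ∣ < ∣ X ∣
    split-< {_} {Y} {Z} (_ , _ , ((i , i∈Z) , _) , d , refl) =
      p⊂q⇒∣p∣<∣q∣ (p⊆p∪q Z , i , q⊆p∪q Y Z i∈Z , λ i∈Y → disjoint⁻ d i∈Y i∈Z)

    -- The edge makes `Y ∪ Z₁` connected, hence a legitimate intermediate piece.
    regroup : ∀ {X Y Z Z₁ Z₂ a b} → Split X Y Z → Split Z Z₁ Z₂ →
      a ∈ Y → b ∈ Z₁ → T (adj G a b) → Split (Y ∪ Z₁) Y Z₁ × Split X (Y ∪ Z₁) Z₂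
    regroup {Y = Y} {Z₁ = Z₁} {Z₂} (x , y , z , d , refl) (_ , z₁ , z₂ , d′ , refl) a∈Y b∈Z₁ e =
        (w , y , z₁ , disjoint⁺ (λ i∈Y → disjoint⁻ d i∈Y ∘ p⊆p∪q Z₂) , refl)
      , (x , w , z₂ , disjoint⁺ apart , ∪-assoc Y Z₁ Z₂)
      where
      w : InC G (Y ∪ Z₁)
      w = connected-∪ y z₁ a∈Y b∈Z₁ e
      apart : ∀ {i} → i ∈ Y ∪ Z₁ → i ∉ Z₂
      apart i∈ i∈Z₂ with x∈p∪q⁻ Y Z₁ i∈
      ... | inj₁ i∈Y  = disjoint⁻ d i∈Y (q⊆p∪q Z₁ Z₂ i∈Z₂)
      ... | inj₂ i∈Z₁ = disjoint⁻ d′ i∈Z₁ i∈Z₂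

    crossing-∪ : ∀ {Y Z} → InC G (Y ∪ Z) → Nonempty Y → Nonempty Z → Disjoint G Y Z →
      ∃ λ a → ∃ λ b → a ∈ Y × b ∈ Z × T (adj G a b)
    crossing-∪ {Y} {Z} (_ , path) (i , i∈Y) (k , k∈Z) d
      with crossing Y (path i k (p⊆p∪q Z i∈Y) (q⊆p∪q Y Z k∈Z)) i∈Y (λ k∈Y → disjoint⁻ d k∈Y k∈Z)
    ... | a , b , a∈Y , b∈ , b∉Y , e =
      a , b , a∈Y , [ ⊥-elim ∘ b∉Y , (λ b∈Z → b∈Z) ]′ (x∈p∪q⁻ Y Z b∈) , e

    -- Y is joined by an edge to Z = Z₁ ∪ Z₂, hence to one of the two parts.
    split-assoc : ∀ {X Y Z Z₁ Z₂} → Split X Y Z → Split Z Z₁ Z₂ →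
      ∃ λ W → (Split W Y Z₁ × Split X W Z₂) ⊎ (Split W Y Z₂ × Split X W Z₁)
    split-assoc {Z₁ = Z₁} {Z₂} s@(x , y , z , d , refl) s′@(_ , _ , _ , _ , refl)
      with crossing-∪ x (proj₁ y) (proj₁ z) d
    ... | _ , _ , a∈Y , b∈Z , e with x∈p∪q⁻ Z₁ Z₂ b∈Z
    ...   | inj₁ b∈Z₁ = _ , inj₁ (regroup s s′ a∈Y b∈Z₁ e)
    ...   | inj₂ b∈Z₂ = _ , inj₂ (regroup s (split-comm s′) a∈Y b∈Z₂ e)

    open SplitClosure (InC G) InC? Split Split? split-inC split-comm split-< split-assoc public

    -- Disjoint unions of several connected sets.

    extract : ∀ Ys {b} → AllPairs (Disjoint G) Ys → b ∈ ⋃ G Ys →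
      ∃ λ Z → ∃ λ Zs → b ∈ Z × Ys ↭ Z ∷ Zs × All (Disjoint G Z) Zs
                     × AllPairs (Disjoint G) Zs × ⋃ G Ys ≡ Z ∪ ⋃ G Zs
    extract [] [] b∈ = ⊥-elim (∉⊥ b∈)
    extract (Y ∷ Ys) (d ∷ ds) b∈ with x∈p∪q⁻ Y (⋃ G Ys) b∈
    ... | inj₁ b∈Y = Y , Ys , b∈Y , ↭.refl , d , ds , refl
    ... | inj₂ b∈Ys with extract Ys ds b∈Ys
    ...   | Z , Zs , b∈Z , p , dZ , dZs , eq with All-resp-↭ p d
    ...     | dYZ ∷ dY = Z , Y ∷ Zs , b∈Z , ↭.trans (↭.prep Y p) (↭.swap Y Z ↭.refl)
                       , disjoint-sym dYZ ∷ dZ , dY ∷ dZs , eq′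
      where
      open ≡-Reasoning
      eq′ : Y ∪ ⋃ G Ys ≡ Z ∪ (Y ∪ ⋃ G Zs)
      eq′ = begin
        Y ∪ ⋃ G Ys         ≡⟨ cong (Y ∪_) eq ⟩
        Y ∪ (Z ∪ ⋃ G Zs)   ≡⟨ ∪-assoc Y Z _ ⟨
        (Y ∪ Z) ∪ ⋃ G Zs   ≡⟨ cong (_∪ ⋃ G Zs) (∪-comm Y Z) ⟩
        (Z ∪ Y) ∪ ⋃ G Zs   ≡⟨ ∪-assoc Z Y _ ⟩
        Z ∪ (Y ∪ ⋃ G Zs)   ∎

    All-disjoint-⋃ : ∀ {Y} Zs → All (Disjoint G Y) Zs → ∀ {i} → i ∈ Y → i ∉ ⋃ G Zs
    All-disjoint-⋃ [] [] i∈Y i∈ = ∉⊥ i∈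
    All-disjoint-⋃ (Z ∷ Zs) (d ∷ ds) i∈Y i∈ with x∈p∪q⁻ Z (⋃ G Zs) i∈
    ... | inj₁ i∈Z  = disjoint⁻ d i∈Y i∈Z
    ... | inj₂ i∈Zs = All-disjoint-⋃ Zs ds i∈Y i∈Zs

    disjoint-⋃-All : ∀ {Y} Zs → (∀ {i} → i ∈ Y → i ∉ ⋃ G Zs) → All (Disjoint G Y) Zs
    disjoint-⋃-All [] h       = []
    disjoint-⋃-All (Z ∷ Zs) h =
      disjoint⁺ (λ i∈Y → h i∈Y ∘ p⊆p∪q (⋃ G Zs)) ∷ disjoint-⋃-All Zs (λ i∈Y → h i∈Y ∘ q⊆p∪q Z (⋃ G Zs))

    ⋃-++ : ∀ Ys Zs → ⋃ G (Ys ++ Zs) ≡ ⋃ G Ys ∪ ⋃ G Zs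
    ⋃-++ [] Zs       = sym (∪-identityˡ _)
    ⋃-++ (Y ∷ Ys) Zs = trans (cong (Y ∪_) (⋃-++ Ys Zs)) (sym (∪-assoc Y _ _))

    module _ {x : Pred n} (x⊆C : x ⊑ InC G) where

      private
        nonempty : ∀ {Y} → Cl x Y → Nonempty Y
        nonempty p = proj₁ (Cl-inC x⊆C p)

      -- As the union is connected, Y has an edge to another piece, which it can
      -- be merged with.
      merge : ∀ m Y Ys → length Ys ≤ m → Cl x Y → All (Cl x) Ys → All (Disjoint G Y) Ys →
        AllPairs (Disjoint G) Ys → InC G (Y ∪ ⋃ G Ys) → Cl x (Y ∪ ⋃ G Ys)
      merge m Y [] le p ps d ds c = subst (Cl x) (sym (∪-identityʳ Y)) p
      merge (suc m) Y Ys@(Y′ ∷ Ys′) le p ps@(p′ ∷ _) d ds c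
        with nonempty p′
      ... | k , k∈Y′ with crossing-∪ {Y} {⋃ G Ys} c (nonempty p) (k , p⊆p∪q (⋃ G Ys′) k∈Y′)
                            (disjoint⁺ (All-disjoint-⋃ Ys d))
      ...   | a , b , a∈Y , b∈Ys , e with extract Ys ds b∈Ys
      ...     | Z , Zs , b∈Z , perm , dZ , dZs , eq with All-resp-↭ perm ps | All-resp-↭ perm d
      ...       | pZ ∷ pZs | dYZ ∷ dY = subst (Cl x) (sym eq′)
        (merge m (Y ∪ Z) Zs (≤-pred (≤-trans (≤-reflexive (sym (↭-length perm))) le))
          (node (cYZ , Cl-inC x⊆C p , Cl-inC x⊆C pZ , dYZ , refl) p pZ) pZs
          (disjoint-⋃-All Zs apart) dZs (subst (InC G) eq′ c))
        where
        eq′ : Y ∪ ⋃ G Ys ≡ (Y ∪ Z) ∪ ⋃ G Zs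
        eq′ = trans (cong (Y ∪_) eq) (sym (∪-assoc Y Z _))
        cYZ : InC G (Y ∪ Z)
        cYZ = connected-∪ (Cl-inC x⊆C p) (Cl-inC x⊆C pZ) a∈Y b∈Z e
        apart : ∀ {i} → i ∈ Y ∪ Z → i ∉ ⋃ G Zs
        apart i∈ with x∈p∪q⁻ Y Z i∈
        ... | inj₁ i∈Y = All-disjoint-⋃ Zs dY i∈Y
        ... | inj₂ i∈Z = All-disjoint-⋃ Zs dZ i∈Z

      φ⇒Cl : φ G x ⊑ Cl x
      φ⇒Cl (c , [] , ne , _) = ⊥-elim (ne refl)
      φ⇒Cl (c , Y ∷ Ys , _ , p ∷ ps , d ∷ ds , refl) =
        merge (length Ys) Y Ys (≤-reflexive refl) (base p) (All.map base ps) d ds c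

      -- The leaves of the generation tree are the pieces of the partition.
      Cl⇒φ : Cl x ⊑ φ G x
      Cl⇒φ {X} (base p) = x⊆C p , X ∷ [] , (λ ()) , p ∷ [] , [] ∷ [] , ∪-identityʳ X
      Cl⇒φ (node (c , _ , _ , d , refl) p q) with Cl⇒φ p | Cl⇒φ q
      ... | _ , Ys , ne , ps , ds , refl | _ , Zs , _ , qs , es , refl =
        c , Ys ++ Zs , (λ eq → ne (++-conicalˡ Ys Zs eq)) , All.++⁺ ps qs
        , AllPairs.++⁺ ds es (across Ys λ {Y} Y⊆ → disjoint-⋃-All Zs (disjoint⁻ d ∘ Y⊆)) , ⋃-++ Ys Zs
        where
        across : ∀ {P : Subset n → Set} Ws → (∀ {W} → W ⊆ ⋃ G Ws → P W) → All P Ws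
        across [] h       = []
        across (W ∷ Ws) h = h (p⊆p∪q (⋃ G Ws)) ∷ across Ws (λ W′⊆ → h (q⊆p∪q W (⋃ G Ws) ∘ W′⊆))

open import Data.Bool using (Bool; true; false; T; T?)
open import Data.Unit using (tt)
open import Data.Empty using (⊥-elim)
open import Data.Fin.Subset using (Subset)
open import Data.Product using (∃; _×_; _,_; proj₁; proj₂)
open import Data.Sum using (_⊎_; inj₁; inj₂)
import Data.Sum as Sum
open import Data.List using (List; map; filter; cartesianProduct)
open import Data.List.Membership.Propositional using () renaming (_∈_ to _∈ᴸ_)
open import Data.List.Membership.Propositional.Properties using (∈-filter⁺; ∈-filter⁻; ∈-map⁺; ∈-map⁻; ∈-cartesianProduct⁺)
open import Relation.Unary using (_⊆_; Decidable; _∪_; _∩_)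
open import Relation.Unary.Properties using (_∩?_; _∪?_)
open import Relation.Binary.PropositionalEquality using (_≡_; refl; sym; trans; subst)
open import Relation.Nullary using (Dec; yes; no; ¬_; ¬?; _×-dec_; _⊎-dec_; ⌊_⌋)
open import Relation.Nullary.Decidable using (toWitness; fromWitness)
open import Function using (_∘_)
open import Function.Bundles using (_⇔_; mk⇔; Equivalence)
open import Level using (0ℓ)
import Algebra.Lattice as Alg
import Relation.Binary.Lattice as Ord
import Relation.Binary.Lattice.Properties.Lattice as OrdLatticeProperties

open FreeLattice
open ClosureSpace
open GraphClosure

-- The lattice of regular closed sets.

T-injective : ∀ {a b} → (T a → T b) → (T b → T a) → a ≡ b
T-injective {false} {false} f g = refl
T-injective {false} {true}  f g = ⊥-elim (g tt)
T-injective {true}  {false} f g = ⊥-elim (f tt)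
T-injective {true}  {true}  f g = refl

module _ {n : ℕ} (G : Graph n) where

  infix 4 _≼_ _≋_

  _≼_ : RG G → RG G → Set
  _≼_ = _⊆R_ G

  _≋_ : RG G → RG G → Set
  _≋_ = _≈R_ G

  ⟪_⟫ : RG G → Pred n
  ⟪ r ⟫ X = T (proj₁ r X)

  ⟪_⟫? : ∀ r → Decidable ⟪ r ⟫
  ⟪ r ⟫? X = T? (proj₁ r X)

  φ̌⊆Int : ∀ {x} → φ̌ G x ⊆ Int G x
  φ̌⊆Int {x} = ∁-anti G {Cl G (∁ G x)} {φ G (∁ G x)} (Cl⇒φ G proj₁)

  Int⊆φ̌ : ∀ {x} → Int G x ⊆ φ̌ G x
  Int⊆φ̌ {x} = ∁-anti G {φ G (∁ G x)} {Cl G (∁ G x)} (φ⇒Cl G proj₁)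

  ⊆Cl-Int : ∀ r → ⟪ r ⟫ ⊆ Cl G (Int G ⟪ r ⟫)
  ⊆Cl-Int (_ , _ , reg) {X} p =
    Cl-mono G φ̌⊆Int (φ⇒Cl G proj₁ (Equivalence.to (reg X) p))

  Cl-Int⊆ : ∀ r → Cl G (Int G ⟪ r ⟫) ⊆ ⟪ r ⟫
  Cl-Int⊆ (_ , _ , reg) {X} p =
    Equivalence.from (reg X) (Cl⇒φ G proj₁ (Cl-mono G Int⊆φ̌ p))

  RG-closed : ∀ r → Closed G ⟪ r ⟫
  RG-closed r s p q = Cl-Int⊆ r (node s (⊆Cl-Int r p) (⊆Cl-Int r q))

  record OpenSet : Set₁ where
    field
      {set}   : Pred n
      dec     : Decidable set
      set⊆InC : set ⊆ InC G
      isOpen  : Open G set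

  open OpenSet

  module _ (U : OpenSet) where

    private
      x : Subset n → Bool
      x X = ⌊ Cl? G (dec U) X ⌋

      x⇒Cl : ToPred G x ⊆ Cl G (set U)
      x⇒Cl {X} = toWitness {a? = Cl? G (dec U) X}

      Cl⇒x : Cl G (set U) ⊆ ToPred G x
      Cl⇒x {X} = fromWitness {a? = Cl? G (dec U) X}

      -- The open set `set U` lies in the interior of its closure, which gives one inclusion;
      -- conversely, a closed set contains the closure of its interior.
      regular : ∀ X → ToPred G x X ⇔ φ G (φ̌ G (ToPred G x)) X
      regular X = mk⇔
        (λ p → Cl⇒φ G proj₁ (Cl-mono G (Int⊆φ̌ ∘ ⊆Int G (set⊆InC U) (isOpen U) (Cl⇒x ∘ base)) (x⇒Cl p)))
        (λ p → Cl⇒x (Cl-least G (x⇒Cl ∘ Int⊆ G (λ X → T? (x X)) ∘ φ̌⊆Int) (Cl-closed G)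
                      (φ⇒Cl G proj₁ p)))

    ofOpen : RG G
    ofOpen = x , (λ X p → Cl-inC G (set⊆InC U) (x⇒Cl p)) , regular

    ofOpen⁻ : ⟪ ofOpen ⟫ ⊆ Cl G (set U)
    ofOpen⁻ = x⇒Cl

    ofOpen⁺ : Cl G (set U) ⊆ ⟪ ofOpen ⟫
    ofOpen⁺ = Cl⇒x

    ofOpen-least : ∀ y → set U ⊆ ⟪ y ⟫ → ofOpen ≼ y
    ofOpen-least y u⊆y X p = Cl-least G u⊆y (RG-closed y) (ofOpen⁻ p)

    ofOpen-upper : ∀ y → Int G ⟪ y ⟫ ⊆ set U → y ≼ ofOpen
    ofOpen-upper y y⊆u X p = ofOpen⁺ (Cl-mono G y⊆u (⊆Cl-Int y p))

  Int-RG⊆ : ∀ r → Int G ⟪ r ⟫ ⊆ ⟪ r ⟫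
  Int-RG⊆ r = Int⊆ G ⟪ r ⟫?

  intOpen : {x : Pred n} → Decidable x → OpenSet
  intOpen x? = record { dec = Int? G x? ; set⊆InC = proj₁ ; isOpen = Int-open G x? }

  unionOpen : OpenSet → OpenSet → OpenSet
  unionOpen U V = record
    { dec     = dec U ∪? dec V
    ; set⊆InC = λ { (inj₁ p) → set⊆InC U p ; (inj₂ p) → set⊆InC V p }
    ; isOpen  = ∪-open G (isOpen U) (isOpen V)
    }

  coOpen : RG G → OpenSet
  coOpen r = record
    { dec = ∁-dec G ⟪ r ⟫? ; set⊆InC = proj₁ ; isOpen = ∁-open G ⟪ r ⟫? (RG-closed r) }

  nbhdOpen : Nbhd G → OpenSet
  nbhdOpen j = record { dec = nbhd? G j ; set⊆InC = nbhd-inC G j ; isOpen = nbhd-open G j }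

  -- The join unites interiors rather than the sets themselves, so that it is visibly the closure of
  -- an open set.
  joinOpen meetOpen : RG G → RG G → OpenSet
  joinOpen a b = unionOpen (intOpen ⟪ a ⟫?) (intOpen ⟪ b ⟫?)
  meetOpen a b = intOpen (⟪ a ⟫? ∩? ⟪ b ⟫?)

  infixr 6 _∨ᴿ_
  infixr 7 _∧ᴿ_

  _∨ᴿ_ : RG G → RG G → RG G
  a ∨ᴿ b = ofOpen (joinOpen a b)

  _∧ᴿ_ : RG G → RG G → RG G
  a ∧ᴿ b = ofOpen (meetOpen a b)

  ∨ᴿ-isLub : ∀ a b → IsLubR G a b (a ∨ᴿ b)
  ∨ᴿ-isLub a b =
      ofOpen-upper (joinOpen a b) a inj₁
    , ofOpen-upper (joinOpen a b) b inj₂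
    , λ d a≼d b≼d → ofOpen-least (joinOpen a b) d
        λ { (inj₁ p) → a≼d _ (Int-RG⊆ a p) ; (inj₂ p) → b≼d _ (Int-RG⊆ b p) }

  ∧ᴿ-isGlb : ∀ a b → IsGlbR G a b (a ∧ᴿ b)
  ∧ᴿ-isGlb a b =
      ofOpen-least (meetOpen a b) a (proj₁ ∘ Int⊆ G (⟪ a ⟫? ∩? ⟪ b ⟫?))
    , ofOpen-least (meetOpen a b) b (proj₂ ∘ Int⊆ G (⟪ a ⟫? ∩? ⟪ b ⟫?))
    , λ d d≼a d≼b → ofOpen-upper (meetOpen a b) d
        (Int-mono G {⟪ d ⟫} {⟪ a ⟫ ∩ ⟪ b ⟫} (λ {X} p → d≼a X p , d≼b X p))

  latticeRG : Ord.Lattice 0ℓ 0ℓ 0ℓ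
  latticeRG = record
    { Carrier = RG G
    ; _≈_ = _≋_
    ; _≤_ = _≼_
    ; _∨_ = _∨ᴿ_
    ; _∧_ = _∧ᴿ_
    ; isLattice = record
      { isPartialOrder = record
        { isPreorder = record
          { isEquivalence = record
            { refl  = λ X → refl
            ; sym   = λ p X → sym (p X)
            ; trans = λ p q X → trans (p X) (q X)
            }
          ; reflexive = λ p X → subst T (p X)
          ; trans = λ p q X → q X ∘ p X
          }
        ; antisym = λ p q X → T-injective (p X) (q X)
        }
      ; supremum = ∨ᴿ-isLub
      ; infimum = ∧ᴿ-isGlb
      }
    }

  module R where
    open Ord.Lattice latticeRG public

  module A = Alg.Lattice (OrdLatticeProperties.algLattice latticeRG)

  -- Complementation and evaluation of terms.

  _ᶜ : RG G → RG G
  r ᶜ = ofOpen (coOpen r)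

  ᶜ-anti : ∀ {a b} → a ≼ b → b ᶜ ≼ a ᶜ
  ᶜ-anti {a} {b} a≼b = ofOpen-least (coOpen b) (a ᶜ)
    (ofOpen⁺ (coOpen a) ∘ base ∘ ∁-anti G {⟪ a ⟫} {⟪ b ⟫} (a≼b _))

  -- The complement of `a ᶜ`, the closure of the complement of `a`, is the interior of `a`; its
  -- closure is `a` by regularity.
  ᶜᶜ : ∀ a → a ᶜ ᶜ ≋ a
  ᶜᶜ a = R.antisym {a ᶜ ᶜ} {a}
    (ofOpen-least (coOpen (a ᶜ)) a
      (Cl-Int⊆ a ∘ base ∘ ∁-anti G {Cl G (∁ G ⟪ a ⟫)} {⟪ a ᶜ ⟫} (ofOpen⁺ (coOpen a))))
    (ofOpen-upper (coOpen (a ᶜ)) a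
      (∁-anti G {⟪ a ᶜ ⟫} {Cl G (∁ G ⟪ a ⟫)} (ofOpen⁻ (coOpen a))))

  -- Formal from `_ᶜ` being an antitone involution, as is `ᶜ-∨`.
  ᶜ-∧ : ∀ a b → (a ∧ᴿ b) ᶜ ≋ a ᶜ ∨ᴿ b ᶜ
  ᶜ-∧ a b = R.antisym {(a ∧ᴿ b) ᶜ} {a ᶜ ∨ᴿ b ᶜ}
    (λ X → R.reflexive {j ᶜ ᶜ} {j} (ᶜᶜ j) X
         ∘ ᶜ-anti {j ᶜ} {a ∧ᴿ b} (R.∧-greatest {j ᶜ} {a} {b}
             (below {a} (R.x≤x∨y (a ᶜ) (b ᶜ))) (below {b} (R.y≤x∨y (a ᶜ) (b ᶜ)))) X)
    (R.∨-least {a ᶜ} {b ᶜ} {(a ∧ᴿ b) ᶜ}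
      (ᶜ-anti {a ∧ᴿ b} {a} (R.x∧y≤x a b)) (ᶜ-anti {a ∧ᴿ b} {b} (R.x∧y≤y a b)))
    where
    j = a ᶜ ∨ᴿ b ᶜ
    below : ∀ {c} → c ᶜ ≼ j → j ᶜ ≼ c
    below {c} p X = R.reflexive {c ᶜ ᶜ} {c} (ᶜᶜ c) X ∘ ᶜ-anti {c ᶜ} {j} p X

  ᶜ-∨ : ∀ a b → (a ∨ᴿ b) ᶜ ≋ a ᶜ ∧ᴿ b ᶜ
  ᶜ-∨ a b = R.antisym {(a ∨ᴿ b) ᶜ} {a ᶜ ∧ᴿ b ᶜ}
    (R.∧-greatest {(a ∨ᴿ b) ᶜ} {a ᶜ} {b ᶜ}
      (ᶜ-anti {a} {a ∨ᴿ b} (R.x≤x∨y a b)) (ᶜ-anti {b} {a ∨ᴿ b} (R.y≤x∨y a b)))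
    (λ X → ᶜ-anti {a ∨ᴿ b} {m ᶜ} (R.∨-least {a} {b} {m ᶜ}
             (above {a} (R.x∧y≤x (a ᶜ) (b ᶜ))) (above {b} (R.x∧y≤y (a ᶜ) (b ᶜ)))) X
         ∘ R.reflexive {m} {m ᶜ ᶜ} (λ Y → sym (ᶜᶜ m Y)) X)
    where
    m = a ᶜ ∧ᴿ b ᶜ
    above : ∀ {c} → m ≼ c ᶜ → c ≼ m ᶜ
    above {c} p X = ᶜ-anti {m} {c ᶜ} p X ∘ R.reflexive {c} {c ᶜ ᶜ} (λ Y → sym (ᶜᶜ c Y)) X

  module _ {X : Set} (e : X → RG G) where

    eval : Term X → RG G
    eval (var x)  = e x
    eval (s ∨ₜ t) = eval s ∨ᴿ eval t
    eval (s ∧ₜ t) = eval s ∧ᴿ eval t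

    eval-resp : ∀ {s t} → s ≈ₜ t → eval s ≋ eval t
    eval-resp {s} ≈-refl        = R.Eq.refl {eval s}
    eval-resp (≈-sym {s} {t} p) = R.Eq.sym {eval s} {eval t} (eval-resp p)
    eval-resp (≈-trans {s} {t} {u} p q) =
      R.Eq.trans {eval s} {eval t} {eval u} (eval-resp p) (eval-resp q)
    eval-resp (∨-cong {s} {s′} {t} {t′} p q) =
      A.∨-cong {eval s} {eval s′} {eval t} {eval t′} (eval-resp p) (eval-resp q)
    eval-resp (∧-cong {s} {s′} {t} {t′} p q) =
      A.∧-cong {eval s} {eval s′} {eval t} {eval t′} (eval-resp p) (eval-resp q)
    eval-resp (∨-comm s t)      = A.∨-comm (eval s) (eval t)
    eval-resp (∧-comm s t)      = A.∧-comm (eval s) (eval t)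
    eval-resp (∨-assoc s t u)   = A.∨-assoc (eval s) (eval t) (eval u)
    eval-resp (∧-assoc s t u)   = A.∧-assoc (eval s) (eval t) (eval u)
    eval-resp (∨-absorbs-∧ s t) = A.∨-absorbs-∧ (eval s) (eval t)
    eval-resp (∧-absorbs-∨ s t) = A.∧-absorbs-∨ (eval s) (eval t)

    eval-mono : ∀ {s t} → s ≤ₜ t → eval s ≼ eval t
    eval-mono {s} {t} s≤t Y p =
      R.x∧y≤y (eval s) (eval t) Y (subst T (sym (eval-resp s≤t Y)) p)

    eval-hom : IsLatticeHomToR G X eval
    eval-hom = record
      { resp  = eval-resp
      ; hom-∨ = λ s t → ∨ᴿ-isLub (eval s) (eval t)
      ; hom-∧ = λ s t → ∧ᴿ-isGlb (eval s) (eval t)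
      }

  -- Induction on `t` by the De Morgan laws.
  eval-dual : ∀ {X : Set} (e : X → RG G) t → eval (_ᶜ ∘ e) t ≋ eval e (dual t) ᶜ
  eval-dual e (var x) = R.Eq.refl {e x ᶜ}
  eval-dual e (s ∨ₜ t) = R.Eq.trans {eval e′ s ∨ᴿ eval e′ t} {a ᶜ ∨ᴿ b ᶜ} {(a ∧ᴿ b) ᶜ}
    (A.∨-cong {eval e′ s} {a ᶜ} {eval e′ t} {b ᶜ} (eval-dual e s) (eval-dual e t))
    (R.Eq.sym {(a ∧ᴿ b) ᶜ} {a ᶜ ∨ᴿ b ᶜ} (ᶜ-∧ a b))
    where
    e′ = _ᶜ ∘ e
    a = eval e (dual s)
    b = eval e (dual t)
  eval-dual e (s ∧ₜ t) = R.Eq.trans {eval e′ s ∧ᴿ eval e′ t} {a ᶜ ∧ᴿ b ᶜ} {(a ∨ᴿ b) ᶜ}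
    (A.∧-cong {eval e′ s} {a ᶜ} {eval e′ t} {b ᶜ} (eval-dual e s) (eval-dual e t))
    (R.Eq.sym {(a ∨ᴿ b) ᶜ} {a ᶜ ∧ᴿ b ᶜ} (ᶜ-∨ a b))
    where
    e′ = _ᶜ ∘ e
    a = eval e (dual s)
    b = eval e (dual t)

  -- Least preimages.

  famOf : RG G → Fam n
  famOf r = fam ⟪ r ⟫?

  Int-famOf⊆ : ∀ r → Int G ⟦ famOf r ⟧ ⊆ ⟪ r ⟫
  Int-famOf⊆ r = fam⁻ ⟪ r ⟫? ∘ Int⊆ G ⟦ famOf r ⟧?

  Int⊆Int-famOf : ∀ r → Int G ⟪ r ⟫ ⊆ Int G ⟦ famOf r ⟧
  Int⊆Int-famOf r = Int-mono G {⟪ r ⟫} {⟦ famOf r ⟧} (fam⁺ ⟪ r ⟫?)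

  -- The closure of the interior makes any family regular closed, so all families can serve as
  -- generators.
  famRG : Fam n → RG G
  famRG F = ofOpen (intOpen ⟦ F ⟧?)

  famRG-famOf : ∀ r → famRG (famOf r) ≋ r
  famRG-famOf r = R.antisym {famRG (famOf r)} {r}
    (ofOpen-least (intOpen ⟦ famOf r ⟧?) r (Int-famOf⊆ r))
    (ofOpen-upper (intOpen ⟦ famOf r ⟧?) r (Int⊆Int-famOf r))

  -- The generator map is left general because the argument is run twice, for `famRG` and for its
  -- complement.
  module LowerBounds (e : Fam n → RG G) (e-surj : ∀ r → ∃ λ F → e F ≋ r) where

    _⊩_ : Nbhd G → Term (Fam n) → Set
    j ⊩ t = nbhd G j ⊆ ⟪ eval e t ⟫

    _⊩?_ : ∀ j t → Dec (j ⊩ t)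
    j ⊩? t = nbhd? G j ⊆? ⟪ eval e t ⟫?

    ⊩var : ∀ j → ∃ λ F → j ⊩ var F
    ⊩var j = F , λ {X} p → subst T (sym (eF≋j X)) (ofOpen⁺ (nbhdOpen j) (base p))
      where
      F = proj₁ (e-surj (ofOpen (nbhdOpen j)))
      eF≋j = proj₂ (e-surj (ofOpen (nbhdOpen j)))

    ⊩-mono : ∀ j {s t} → s ≤ₜ t → j ⊩ s → j ⊩ t
    ⊩-mono j s≤t p = eval-mono e s≤t _ ∘ p

    ⊩-∧ : ∀ j s t → j ⊩ s → j ⊩ t → j ⊩ (s ∧ₜ t)
    ⊩-∧ j s t p q = ofOpen⁺ (meetOpen (eval e s) (eval e t)) ∘ base
      ∘ ⊆Int G (nbhd-inC G j) (nbhd-open G j) (λ i → p i , q i)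

    -- Families stand in for the values of the two joinands, so finitely many pairs account for the
    -- joins of all terms.
    Covers : Nbhd G → Fam n × Fam n → Set
    Covers j (B , C) = nbhd G j ⊆ Cl G (Int G ⟦ B ⟧ ∪ Int G ⟦ C ⟧)
      × ¬ (nbhd G j ⊆ Int G ⟦ B ⟧) × ¬ (nbhd G j ⊆ Int G ⟦ C ⟧)

    covers? : ∀ j → Decidable (Covers j)
    covers? j (B , C) =
      (nbhd? G j ⊆? Cl? G (Int? G ⟦ B ⟧? ∪? Int? G ⟦ C ⟧?))
      ×-dec ¬? (nbhd? G j ⊆? Int? G ⟦ B ⟧?) ×-dec ¬? (nbhd? G j ⊆? Int? G ⟦ C ⟧?)

    Refines : Nbhd G → Fam n × Fam n → Nbhd G → Set
    Refines j (B , C) i =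
      _≺_ G i j × (nbhd G i ⊆ Int G ⟦ B ⟧ ⊎ nbhd G i ⊆ Int G ⟦ C ⟧)

    refines? : ∀ j BC → Decidable (Refines j BC)
    refines? j (B , C) i = _≺?_ G i j
      ×-dec ((nbhd? G i ⊆? Int? G ⟦ B ⟧?) ⊎-dec (nbhd? G i ⊆? Int? G ⟦ C ⟧?))

    -- All lower neighbourhoods inside either side are taken at once, so no minimal cover has to be
    -- chosen.
    refinement : Nbhd G → Fam n × Fam n → List (Nbhd G)
    refinement j BC = filter (refines? j BC) (allNbhds G)

    covers : Nbhd G → List (List (Nbhd G))
    covers j = map (refinement j)
      (filter (covers? j) (cartesianProduct (allFams n) (allFams n)))

    covers⁻ : ∀ j {L} → L ∈ᴸ covers j → ∃ λ BC → Covers j BC × L ≡ refinement j BC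
    covers⁻ j L∈ =
      let BC , BC∈ , eq = ∈-map⁻ (refinement j) L∈
      in BC , proj₂ (∈-filter⁻ (covers? j) {xs = cartesianProduct (allFams n) (allFams n)} BC∈) , eq

    refinement⁻ : ∀ j BC {i} → i ∈ᴸ refinement j BC → Refines j BC i
    refinement⁻ j BC i∈ = proj₂ (∈-filter⁻ (refines? j BC) {xs = allNbhds G} i∈)

    covers-≺ : ∀ j {L} → L ∈ᴸ covers j → ∀ {i} → i ∈ᴸ L → _≺_ G i j
    covers-≺ j L∈ {i} i∈ =
      let BC , _ , eq = covers⁻ j L∈
      in proj₁ (refinement⁻ j BC (subst (i ∈ᴸ_) eq i∈))

    -- This is `nbhd-cover` with the value of `t` as the closed set.
    covers-sound : ∀ j {L} → L ∈ᴸ covers j → ∀ t → (∀ {i} → i ∈ᴸ L → i ⊩ t) → j ⊩ t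
    covers-sound j L∈ t L⊩t =
      let (B , C) , (j⊆ , j⊈B , j⊈C) , eq = covers⁻ j L∈
      in nbhd-cover G j (Int? G ⟦ B ⟧?) (Int? G ⟦ C ⟧?) proj₁ proj₁
        (Int-open G ⟦ B ⟧?) (Int-open G ⟦ C ⟧?) j⊆ (RG-closed (eval e t))
        (λ i i≺j side → L⊩t (subst (i ∈ᴸ_) (sym eq)
          (∈-filter⁺ (refines? j (B , C)) (allNbhds-complete G i) (i≺j , side))))
        j⊈B j⊈C

    covers-complete : ∀ j s t → j ⊩ (s ∨ₜ t) → (j ⊩ s) ⊎ (j ⊩ t) ⊎
      ∃ λ L → L ∈ᴸ covers j × (∀ {i} → i ∈ᴸ L → (i ⊩ s) ⊎ (i ⊩ t))
    covers-complete j s t j⊩ with j ⊩? s | j ⊩? t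
    ... | yes p | _     = inj₁ p
    ... | no _  | yes q = inj₂ (inj₁ q)
    ... | no ¬p | no ¬q = inj₂ (inj₂ (refinement j BC , L∈ , sides))
      where
      a = eval e s
      b = eval e t
      BC = famOf a , famOf b
      covering : Covers j BC
      covering =
          Cl-mono G (Sum.map (Int⊆Int-famOf a) (Int⊆Int-famOf b)) ∘ ofOpen⁻ (joinOpen a b) ∘ j⊩
        , (λ h → ¬p (Int-famOf⊆ a ∘ h)) , (λ h → ¬q (Int-famOf⊆ b ∘ h))
      L∈ : refinement j BC ∈ᴸ covers j
      L∈ = ∈-map⁺ (refinement j) (∈-filter⁺ (covers? j)
        (∈-cartesianProduct⁺ (allFams-complete n (famOf a)) (allFams-complete n (famOf b))) covering)
      sides : ∀ {i} → i ∈ᴸ refinement j BC → (i ⊩ s) ⊎ (i ⊩ t)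
      sides {i} i∈ = Sum.map (λ h {X} → Int-famOf⊆ a ∘ h {X}) (λ h {X} → Int-famOf⊆ b ∘ h {X})
        (proj₂ (refinement⁻ j BC i∈))

    least-above : (L : List (Nbhd G)) →
      ∃ λ t → (∀ {j} → j ∈ᴸ L → j ⊩ t) × (∀ s → (∀ {j} → j ∈ᴸ L → j ⊩ s) → t ≤ₜ s)
    least-above = FiniteVars.JoinCovers.least-above
      -- The first family is an arbitrary choice for the generator `x₀`.
      (fam (InC? G)) (allFams n) (allFams-complete n)
      (_≺_ G) (≺-wellFounded G) _⊩_ (λ j F → j ⊩? var F) ⊩var
      (λ j {s} {t} → ⊩-mono j {s} {t}) ⊩-∧ covers covers-≺ covers-sound covers-complete

    nbhds : RG G → List (Nbhd G)
    nbhds y = filter (λ j → nbhd? G j ⊆? ⟪ y ⟫?) (allNbhds G)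

    -- The least term above all neighbourhoods inside `y` works: they generate `y`, so its value is
    -- at least `y`, and it lies below `t₀`, so its value is at most `y`.
    least-preimage : ∀ y t₀ → eval e t₀ ≋ y →
      ∃ λ t → eval e t ≋ y × (∀ s → eval e s ≋ y → t ≤ₜ s)
    least-preimage y t₀ t₀≋y = t , R.antisym {eval e t} {y} t≼y y≼t , t≤
      where
      above = least-above (nbhds y)
      t = proj₁ above
      nbhds⊩t = proj₁ (proj₂ above)
      t-min = proj₂ (proj₂ above)
      t≤ : ∀ s → eval e s ≋ y → t ≤ₜ s
      t≤ s s≋y = t-min s λ j∈ {X} → subst T (sym (s≋y X))
        ∘ proj₂ (∈-filter⁻ (λ j → nbhd? G j ⊆? ⟪ y ⟫?) {xs = allNbhds G} j∈)
      t≼y : eval e t ≼ y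
      t≼y X = subst T (t₀≋y X) ∘ eval-mono e (t≤ t₀ t₀≋y) X
      int? = Int? G ⟪ y ⟫?
      -- Each member `q` of the interior lies in a listed neighbourhood, the one with apex `q`.
      int⊆t : Int G ⟪ y ⟫ ⊆ ⟪ eval e t ⟫
      int⊆t {q} p = nbhds⊩t
        (∈-filter⁺ (λ j → nbhd? G j ⊆? ⟪ y ⟫?) (allNbhds-complete G (at G int? q))
          (Int⊆ G ⟪ y ⟫? ∘ at⁻ G int? q))
        (at⁺ G int? q proj₁ (Int-open G ⟪ y ⟫?) (p , inj₁ refl))
      y≼t : y ≼ eval e t
      y≼t X p = Cl-least G int⊆t (RG-closed (eval e t)) (⊆Cl-Int y p)

  -- Surjectivity and boundedness of the evaluation.

  famRG-surj : ∀ r → ∃ λ F → famRG F ≋ r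
  famRG-surj r = famOf r , famRG-famOf r

  ᶜ-cong : ∀ {a b} → a ≋ b → a ᶜ ≋ b ᶜ
  ᶜ-cong {a} {b} p = R.antisym {a ᶜ} {b ᶜ}
    (ᶜ-anti {b} {a} (R.reflexive {b} {a} (λ X → sym (p X)))) (ᶜ-anti {a} {b} (R.reflexive {a} {b} p))

  famRGᶜ-surj : ∀ r → ∃ λ F → famRG F ᶜ ≋ r
  famRGᶜ-surj r = famOf (r ᶜ) , λ X →
    trans (ᶜ-cong {famRG (famOf (r ᶜ))} {r ᶜ} (famRG-famOf (r ᶜ)) X) (ᶜᶜ r X)

  eval-surjective : Surjective G (Fam n) (eval famRG)
  eval-surjective r = var (famOf r) , famRG-famOf r

  -- The complement turns the greatest preimage of y into the dual of the least
  -- preimage of y ᶜ under the complemented generators.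
  eval-bounded : Bounded G (Fam n) (eval famRG)
  eval-bounded y =
      LowerBounds.least-preimage famRG famRG-surj y (var (famOf y)) (famRG-famOf y)
    , dual t , t≋y , λ s s≋y → subst (_≤ₜ dual t) (dual-involutive s)
        (dual-antitone (t-min (dual s) (dual-preimage s s≋y)))
    where
    F = famRGᶜ-surj (y ᶜ)
    least = LowerBounds.least-preimage (_ᶜ ∘ famRG) famRGᶜ-surj (y ᶜ) (var (proj₁ F)) (proj₂ F)
    t = proj₁ least
    t-min = proj₂ (proj₂ least)

    t≋y : eval famRG (dual t) ≋ y
    t≋y X = trans (sym (ᶜᶜ a X)) (trans (ᶜ-cong {a ᶜ} {y ᶜ} aᶜ≋yᶜ X) (ᶜᶜ y X))
      where
      a = eval famRG (dual t)
      aᶜ≋yᶜ : a ᶜ ≋ y ᶜ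
      aᶜ≋yᶜ Y = trans (sym (eval-dual famRG t Y)) (proj₁ (proj₂ least) Y)

    dual-preimage : ∀ s → eval famRG s ≋ y → eval (_ᶜ ∘ famRG) (dual s) ≋ y ᶜ
    dual-preimage s s≋y X = trans (eval-dual famRG (dual s) X)
      (ᶜ-cong {eval famRG (dual (dual s))} {y}
        (subst (λ r → eval famRG r ≋ y) (sym (dual-involutive s)) s≋y) X)

theorem13p11 : (n : ℕ) (G : Graph n) → BoundedHomImageOfFree G
theorem13p11 n G =
  Fam n , eval G (famRG G) , eval-hom G (famRG G) , eval-surjective G , eval-bounded G
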